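{- Let $T$ be a string of length $n$ over an alphabet $\Sigma$, and let $T'$ be any string with edit distance $\mathrm{ed}(T,T')=1$ (so $T'$ is obtained from $T$ by a single character insertion, deletion, or substitution; $|T'|\in\{n+1,n-1,n\}$ accordingly). Then $$\mathsf{size}(T') \le 8\,\mathsf{size}(T)+4 .$$ Consequently, for the worst-case multiplicative sensitivities $\mathrm{MS}_{\mathrm{ins}}(\mathsf{size},n)$, $\mathrm{MS}_{\mathrm{del}}(\mathsf{size},n)$, $\mathrm{MS}_{\mathrm{sub}}(\mathsf{size},n)$, every ratio $\mathsf{size}(T')/\mathsf{size}(T)$ over which these maxima are taken is at most $(8\,\mathsf{size}(T)+4)/\mathsf{size}(T)$.
   Context: Strings are over a finite alphabet $\Sigma$. For a string $T$, $\mathrm{Substr}(T)$, $\mathrm{Prefix}(T)$, $\mathrm{Suffix}(T)$ denote its sets of substrings, prefixes and suffixes (each including the empty string $\varepsilon$). A string $w\in\mathrm{Substr}(T)$ is left-maximal in $T$ if $w\in\mathrm{Prefix}(T)$ or there exist distinct characters $a,b\in\Sigma$ with $aw,bw\in\mathrm{Substr}(T)$; it is right-maximal in $T$ if $w\in\mathrm{Suffix}(T)$ or there exist distinct $a,b\in\Sigma$ with $wa,wb\in\mathrm{Substr}(T)$. Let $\mathsf{LeftM}(T)$, $\mathsf{RightM}(T)$ be the sets of left-maximal and right-maximal substrings of $T$ and $\mathsf{M}(T)=\mathsf{LeftM}(T)\cap\mathsf{RightM}(T)$. For a string $x$, let $\mathsf{D}_T(x)=|\{a\in\Sigma : xa\in\mathrm{Substr}(T)\}|$.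 The size of the compact directed acyclic word graph (CDAWG) of $T$ is $\mathsf{size}(T)=\sum_{x\in\mathsf{M}(T)}\mathsf{D}_T(x)$ (its number of edges). With $\mathcal{K}(T,1)=\{S:\mathrm{ed}(S,T)=1\}$, the sensitivities are $\mathrm{MS}_{\mathrm{ins}}(\mathsf{size},n)=\max_{T\in\Sigma^n,\,T'\in\mathcal{K}(T,1)\cap\Sigma^{n+1}}\mathsf{size}(T')/\mathsf{size}(T)$, and analogously $\mathrm{MS}_{\mathrm{del}}$ with $\Sigma^{n-1}$ and $\mathrm{MS}_{\mathrm{sub}}$ with $\Sigma^{n}$. -}

module Defs where

open import Data.Fin using (Fin)
import Data.Fin.Properties as Fin
open import Data.Integer using (+_)
open import Data.List using (List; []; _∷_; _++_; _∷ʳ_; length; map; filter; deduplicate; concatMap; inits; tails; allFin)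
open import Data.List.Membership.Propositional using () renaming (_∈_ to _∈ˡ_)
open import Data.List.Membership.Propositional.Properties
open import Data.List.Properties using (≡-dec)
open import Data.List.Relation.Binary.Infix.Heterogeneous using (Infix; here; there)
open import Data.List.Relation.Binary.Infix.Heterogeneous.Properties using (infix?)
open import Data.List.Relation.Binary.Pointwise using ([])
open import Data.List.Relation.Binary.Prefix.Heterogeneous using ([]; _∷_) renaming (Prefix to IsPrefix)
open import Data.List.Relation.Binary.Prefix.Heterogeneous.Properties using (prefix?)
open import Data.List.Relation.Binary.Suffix.Heterogeneous as Suf using () renaming (Suffix to IsSuffix)
open import Data.List.Relation.Binary.Suffix.Heterogeneous.Properties using (suffix?)
open import Data.List.Relation.Unary.Any using (here; there)
open import Data.List.Relation.Unary.Unique.Propositional using (Unique)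
import Data.List.Relation.Unary.Unique.DecPropositional.Properties as Unique
import Data.List.Relation.Unary.Unique.Propositional.Properties as UniqueP
open import Data.Nat using (ℕ; suc; _+_; _∸_; _≤_; NonZero; >-nonZero)
open import Data.Nat.ListAction using (sum)
import Data.Nat.Properties as ℕ
open import Data.Product using (∃; ∃₂; _×_; _,_; proj₁; proj₂)
open import Data.Rational using (ℚ) renaming (_/_ to _/ℚ_; _≤_ to _≤ℚ_)
open import Data.Sum using (_⊎_; inj₁)
open import Function using (_⇔_; mk⇔; Equivalence; it)
open import Relation.Binary.Definitions using (DecidableEquality)
open import Relation.Binary.PropositionalEquality using (_≡_; _≢_; refl; sym; subst)
open import Relation.Nullary.Decidable using (¬?; _×-dec_; _⊎-dec_)
open import Relation.Unary using (Pred; _∈_; _∩_; Decidable)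

private
  variable
    σ : ℕ

-- The alphabet Σ is Fin σ.
Str : ℕ → Set
Str σ = List (Fin σ)

_≟ˢ_ : DecidableEquality (Str σ)
_≟ˢ_ = ≡-dec Fin._≟_

Substr Prefix Suffix : Str σ → Pred (Str σ) _
Substr T w = Infix _≡_ w T
Prefix T w = IsPrefix _≡_ w T
Suffix T w = IsSuffix _≡_ w T

LeftM RightM M : Str σ → Pred (Str σ) _
LeftM T w = w ∈ Substr T ×
  (w ∈ Prefix T ⊎ ∃₂ λ a b → a ≢ b × a ∷ w ∈ Substr T × b ∷ w ∈ Substr T)
RightM T w = w ∈ Substr T ×
  (w ∈ Suffix T ⊎ ∃₂ λ a b → a ≢ b × w ∷ʳ a ∈ Substr T × w ∷ʳ b ∈ Substr T)
M T = LeftM T ∩ RightM T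

substr? : (T : Str σ) → Decidable (Substr T)
substr? T w = infix? Fin._≟_ w T

leftM? : (T : Str σ) → Decidable (LeftM T)
leftM? T w = substr? T w ×-dec
  (prefix? Fin._≟_ w T ⊎-dec
   Fin.any? λ a → Fin.any? λ b →
     ¬? (a Fin.≟ b) ×-dec substr? T (a ∷ w) ×-dec substr? T (b ∷ w))

rightM? : (T : Str σ) → Decidable (RightM T)
rightM? T w = substr? T w ×-dec
  (suffix? Fin._≟_ w T ⊎-dec
   Fin.any? λ a → Fin.any? λ b →
     ¬? (a Fin.≟ b) ×-dec substr? T (w ∷ʳ a) ×-dec substr? T (w ∷ʳ b))

M? : (T : Str σ) → Decidable (M T)
M? T w = leftM? T w ×-dec rightM? T w

substrings : Str σ → List (Str σ)
substrings T = deduplicate _≟ˢ_ (concatMap inits (tails T))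

maximals : Str σ → List (Str σ)
maximals T = filter (M? T) (substrings T)

D : Str σ → Str σ → ℕ
D {σ} T x = length (filter (λ a → substr? T (x ∷ʳ a)) (allFin σ))

size : Str σ → ℕ
size T = sum (map (D T) (maximals T))

-- The sum defining size ranges over each element of M T exactly once
-- (maximals-unique, ∈-maximals).

maximals-unique : (T : Str σ) → Unique (maximals T)
maximals-unique T =
  UniqueP.filter⁺ (M? T) (Unique.deduplicate-! _≟ˢ_ (concatMap inits (tails T)))

private
  ∈-inits⁺ : ∀ {w T : Str σ} → w ∈ Prefix T → w ∈ˡ inits T
  ∈-inits⁺ []         = here refl
  ∈-inits⁺ (refl ∷ p) = there (∈-map⁺ _ (∈-inits⁺ p))

  ∈-factors⁺ : ∀ {w T : Str σ} → w ∈ Substr T → w ∈ˡ concatMap inits (tails T)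
  ∈-factors⁺ {T = []}    (here p)  = ∈-++⁺ˡ (∈-inits⁺ p)
  ∈-factors⁺ {T = _ ∷ _} (here p)  = ∈-++⁺ˡ (∈-inits⁺ p)
  ∈-factors⁺ {T = a ∷ T} (there i) = ∈-++⁺ʳ (inits (a ∷ T)) (∈-factors⁺ i)

∈-maximals : ∀ (T : Str σ) {w} → w ∈ˡ maximals T ⇔ w ∈ M T
∈-maximals T = mk⇔
  (λ w∈ → proj₂ (∈-filter⁻ (M? T) {xs = substrings T} w∈))
  (λ m → ∈-filter⁺ (M? T) (∈-deduplicate⁺ _≟ˢ_ (∈-factors⁺ (proj₁ (proj₁ m)))) m)

private
  ε∈M : (T : Str σ) → [] ∈ M T
  ε∈M T = (here [] , inj₁ []) , (here [] , inj₁ (ε-suffix T))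
    where
    ε-suffix : (T : Str σ) → [] ∈ Suffix T
    ε-suffix []      = Suf.here []
    ε-suffix (_ ∷ T) = Suf.there (ε-suffix T)

  ≤-sum-map : ∀ {A : Set} (f : A → ℕ) {x xs} → x ∈ˡ xs → f x ≤ sum (map f xs)
  ≤-sum-map f (here refl) = ℕ.m≤m+n _ _
  ≤-sum-map f {xs = y ∷ _} (there x∈) =
    ℕ.≤-trans (≤-sum-map f x∈) (ℕ.m≤n+m _ (f y))

size-nonZero : (T : Str σ) → .{{NonZero (length T)}} → NonZero (size T)
size-nonZero T@(a ∷ _) = >-nonZero (ℕ.<-≤-trans
  (∈-length (∈-filter⁺ (λ b → substr? T ([] ∷ʳ b)) (∈-allFin a) (here (refl ∷ []))))
  (≤-sum-map (D T) (Equivalence.from (∈-maximals T) (ε∈M T))))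

data Edit {σ} : Str σ → Str σ → Set where
  insertion    : ∀ u a v   → Edit (u ++ v)     (u ++ a ∷ v)
  deletion     : ∀ u a v   → Edit (u ++ a ∷ v) (u ++ v)
  substitution : ∀ u a b v → Edit (u ++ a ∷ v) (u ++ b ∷ v)

data Edits {σ} : ℕ → Str σ → Str σ → Set where
  done : ∀ {S} → Edits 0 S S
  step : ∀ {k S T U} → Edit S T → Edits k T U → Edits (suc k) S U

ed[_,_]≡_ : Str σ → Str σ → ℕ → Set
ed[ S , T ]≡ d = Edits d S T × (∀ k → Edits k S T → d ≤ k)

𝒦 : Str σ → ℕ → Pred (Str σ) _
𝒦 T d S = ed[ S , T ]≡ d

data Op : Set where
  ins del sub : Op

editedLength : Op → ℕ → ℕ
editedLength ins n = n + 1
editedLength del n = n ∸ 1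
editedLength sub n = n

-- The pairs (T , T′) over which MS_op(size , n) is a maximum.
record Pair (σ : ℕ) (op : Op) (n : ℕ) : Set where
  field
    T T′      : Str σ
    length-T  : length T ≡ n
    T′∈𝒦      : T′ ∈ 𝒦 T 1
    length-T′ : length T′ ≡ editedLength op n

-- For n = 0 the denominator size ε is 0, so ratios are taken for n ≥ 1.
module _ {op n} .{{_ : NonZero n}} (p : Pair σ op n) where
  open Pair p

  size-T-nonZero : NonZero (size T)
  size-T-nonZero = size-nonZero T {{subst NonZero (sym length-T) it}}

  ratio : ℚ
  ratio = (+ size T′ /ℚ size T) {{size-T-nonZero}}

-- A relation rather than a function of op and n, because the set of pairs may be empty (sub, σ = 1).
MS : (σ : ℕ) (op : Op) (n : ℕ) .{{_ : NonZero n}} → ℚ → Set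
MS σ op n q =
  (∃ λ (p : Pair σ op n) → ratio p ≡ q) × (∀ (p : Pair σ op n) → ratio p ≤ℚ q)

{-# OPTIONS --safe #-}

-- Every edit with nonempty result can be written as T = u c v, T′ = u d v with d a
-- letter and c an arbitrary string. The edges (x,a) of the CDAWG of T′ are injected
-- into eight copies of the edges of T and four extra targets. Call a string old if
-- it occurs in u or in v. If xa is old, then either x is maximal in T, and (x,a) is
-- kept; or x is not left-maximal in T, and then x is the longest old suffix of u d s
-- for some prefix s of v and is charged to the left-maximal extension of s; or x is
-- not right-maximal in T, and then a is unique and x is the longest old prefix of p
-- d v for some suffix p of u. In the last case, and also when x is old but xa is
-- not, (x,a) is determined by p and is charged to the maximal extension of p in T.
-- If x is not old, let p d s be its first occurrence across d: then s is maximal in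
-- T, and (s,a) is charged. Injectivity rests on two facts: a string occurs only once
-- in its maximal extension, and among several overlapping occurrences of a string
-- all but the first are preceded by the same letter.
module Submission where

open import Defs
open import Data.Integer using (+_)
open import Data.Nat using (ℕ; _+_; _*_; _≤_; NonZero)
open import Data.Product using (_×_)
open import Data.Rational using () renaming (_/_ to _/ℚ_; _≤_ to _≤ℚ_)

open import Data.Bool using (true; false)
open import Data.Empty using (⊥)
open import Data.Fin using (Fin)
import Data.Fin.Properties as Fin
import Data.Integer as ℤ
import Data.Integer.Properties as ℤ
open import Data.List using (List; []; _∷_; _++_; _∷ʳ_; length; map; filter; allFin; cartesianProduct; initLast; _∷ʳ′_)
open import Data.List.Membership.Propositional using () renaming (_∈_ to _∈ˡ_)
open import Data.List.Membership.Propositional.Properties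
open import Data.List.Properties
open import Data.List.Relation.Binary.Infix.Heterogeneous as Infix using (MkView)
open import Data.List.Relation.Binary.Pointwise using (≡⇒Pointwise-≡; Pointwise-≡⇒≡)
import Data.List.Relation.Binary.Prefix.Heterogeneous as Pre
open import Data.List.Relation.Binary.Prefix.Heterogeneous.Properties using (prefix?)
import Data.List.Relation.Binary.Suffix.Heterogeneous as Suf
open import Data.List.Relation.Unary.All as All using ()
open import Data.List.Relation.Unary.AllPairs using (_∷_)
open import Data.List.Relation.Unary.Any using (here; there)
open import Data.List.Relation.Unary.Unique.Propositional using (Unique)
import Data.List.Relation.Unary.Unique.Propositional.Properties as Unique
open import Data.List.Reverse using (Reverse; []; _∶_∶ʳ_; reverseView)
open import Data.Nat using (zero; suc; _<_; z≤n; s≤s; s≤s⁻¹)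
open import Data.Nat.ListAction using (sum)
open import Data.Nat.Properties as ℕ using (≤-refl; ≤-trans; ≤-reflexive)
open import Data.Product using (∃; ∃₂; _,_; proj₁; proj₂)
open import Data.Rational using (toℚᵘ)
import Data.Rational.Properties as ℚ
open import Data.Rational.Unnormalised as ℚᵘ using (mkℚᵘ)
import Data.Rational.Unnormalised.Properties as ℚᵘ
open import Data.Sum using (_⊎_; inj₁; inj₂; [_,_]′)
open import Function using (_∘_; Equivalence)
open import Relation.Binary.PropositionalEquality
open import Relation.Nullary using (¬_; Dec; does; yes; no; contradiction)
open import Relation.Nullary.Decidable using (map′; _⊎-dec_)
open import Relation.Unary using (_∈_; Decidable)

private
  variable
    σ : ℕ
    A B : Set

-- Prefixes, suffixes and factors

infix 4 _≼_ _≽_ _⊑_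

_≼_ _≽_ _⊑_ : List A → List A → Set
w ≼ t = ∃ λ r → w ++ r ≡ t
w ≽ t = ∃ λ l → l ++ w ≡ t
w ⊑ t = ∃₂ λ l r → l ++ w ++ r ≡ t

≼⇒⊑ : {w t : List A} → w ≼ t → w ⊑ t
≼⇒⊑ (r , e) = [] , r , e

≽⇒⊑ : {w t : List A} → w ≽ t → w ⊑ t
≽⇒⊑ {w = w} (l , e) = l , [] , trans (cong (l ++_) (++-identityʳ w)) e

++-assoc₄ : (a b c {e} : List A) → (a ++ b ++ c) ++ e ≡ a ++ b ++ c ++ e
++-assoc₄ a b c {e} = trans (++-assoc a (b ++ c) e) (cong (a ++_) (++-assoc b c e))

⊑-trans : {w t z : List A} → w ⊑ t → t ⊑ z → w ⊑ z
⊑-trans {w = w} (l , r , refl) (l′ , r′ , refl) = l′ ++ l , r ++ r′ ,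
  trans (++-assoc l′ l (w ++ r ++ r′)) (cong (l′ ++_) (sym (++-assoc₄ l w r)))

≼-trans : {w t z : List A} → w ≼ t → t ≼ z → w ≼ z
≼-trans {w = w} (r , refl) (r′ , refl) = r ++ r′ , sym (++-assoc w r r′)

≽-trans : {w t z : List A} → w ≽ t → t ≽ z → w ≽ z
≽-trans {w = w} (l , refl) (l′ , refl) = l′ ++ l , ++-assoc l′ l w

≼-length : {w t : List A} → w ≼ t → length w ≤ length t
≼-length {w = w} (r , refl) = length-++-≤ˡ w

≽-length : {w t : List A} → w ≽ t → length w ≤ length t
≽-length {w = w} (l , refl) = length-++-≤ʳ w {l}

⊑-length : {w t : List A} → w ⊑ t → length w ≤ length t
⊑-length {w = w} (l , r , refl) = ≤-trans (≼-length {w = w} (r , refl)) (≽-length {w = w ++ r} (l , refl))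

++-≼ : ∀ (l : List A) {w t} → w ≼ t → l ++ w ≼ l ++ t
++-≼ l {w} (r , refl) = r , ++-assoc l w r

¬∷⇒[] : (w : List A) → (∀ a t → w ≢ a ∷ t) → w ≡ []
¬∷⇒[] []      _ = refl
¬∷⇒[] (a ∷ w) h = contradiction refl (h a w)

¬∷ʳ⇒[] : (w : List A) → (∀ t a → w ≢ t ∷ʳ a) → w ≡ []
¬∷ʳ⇒[] w h with initLast w
... | []      = refl
... | w ∷ʳ′ a = contradiction refl (h w a)

levi : ∀ (a {b} c {e} : List A) → a ++ b ≡ c ++ e → length a ≤ length c →
       ∃ λ k → c ≡ a ++ k × b ≡ k ++ e
levi []      c        eq _   = c , refl , eq
levi (x ∷ a) (y ∷ c)  eq a≤c with refl , eq′ ← ∷-injective eq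
  with k , refl , eq″ ← levi a c eq′ (s≤s⁻¹ a≤c) = k , refl , eq″

levi-≽ : ∀ (a {b} c {e} : List A) → a ++ b ≡ c ++ e → length b ≤ length e →
         ∃ λ k → a ≡ c ++ k × e ≡ k ++ b
levi-≽ a {b} c {e} eq b≤e with ℕ.≤-total (length c) (length a)
... | inj₁ c≤a = levi c a (sym eq) c≤a
... | inj₂ a≤c with levi a c eq a≤c
...   | [] , refl , refl = [] , sym (trans (++-identityʳ _) (++-identityʳ a)) , refl
...   | x ∷ k , refl , refl =
        contradiction (≤-trans (s≤s (≽-length {w = e} (k , refl))) b≤e) (ℕ.<-irrefl refl)

≼-compare : {a b t : List A} → a ≼ t → b ≼ t → length a ≤ length b → a ≼ b
≼-compare {a = a} {b} (r , e) (r′ , e′) a≤b with k , q , _ ← levi a b (trans e (sym e′)) a≤b = k , sym q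

≽-compare : {a b t : List A} → a ≽ t → b ≽ t → length a ≤ length b → a ≽ b
≽-compare (r , e) (r′ , e′) a≤b with k , _ , q ← levi-≽ r r′ (trans e (sym e′)) a≤b = k , sym q

≼-antisym-length : {a b t : List A} → a ≼ t → b ≼ t → length a ≡ length b → a ≡ b
≼-antisym-length a≼t b≼t eq with ≼-compare a≼t b≼t (≤-reflexive eq)
... | [] , q = trans (sym (++-identityʳ _)) q
≼-antisym-length {a = a} _ _ eq | x ∷ k , refl =
  contradiction (trans eq (length-++ a)) (ℕ.m≢1+m+n _ ∘ (λ q → trans q (ℕ.+-suc (length a) (length k))))

++-length-cancel : ∀ (a b : List A) {e f} → a ++ e ≡ b ++ f → length a ≡ length b → a ≡ b × e ≡ f
++-length-cancel a b {e} eq la with refl ← ≼-antisym-length {a = a} {b} (_ , eq) (_ , refl) la = refl , ++-cancelˡ a _ _ eq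

∷ʳ-⊑ : ∀ (w {t} : List A) {a} → w ∷ʳ a ⊑ t → ∃₂ λ l r → l ++ w ++ a ∷ r ≡ t
∷ʳ-⊑ w {a = a} (l , r , e) = l , r , trans (cong (l ++_) (sym (∷ʳ-++ w a _))) e

⊑-∷ʳ : ∀ (l w : List A) {t a r} → l ++ w ++ a ∷ r ≡ t → w ∷ʳ a ⊑ t
⊑-∷ʳ l w {a = a} {r} e = l , r , trans (cong (l ++_) (∷ʳ-++ w a _)) e

w≼w∷ʳa : ∀ {w : List A} {a} → w ≼ w ∷ʳ a
w≼w∷ʳa {a = a} = a ∷ [] , refl

w≽a∷w : ∀ {w : List A} {a} → w ≽ a ∷ w
w≽a∷w {a = a} = a ∷ [] , refl

Substr⇒⊑ : {w T : Str σ} → w ∈ Substr T → w ⊑ T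
Substr⇒⊑ i with Infix.toView i
... | MkView l p r with refl ← Pointwise-≡⇒≡ p = l , r , refl

⊑⇒Substr : {w T : Str σ} → w ⊑ T → w ∈ Substr T
⊑⇒Substr (l , r , refl) = Infix.fromView (MkView l (≡⇒Pointwise-≡ refl) r)

Prefix⇒≼ : {w T : Str σ} → w ∈ Prefix T → w ≼ T
Prefix⇒≼ i with Pre.toView i
... | p Pre.++ r with refl ← Pointwise-≡⇒≡ p = r , refl

≼⇒Prefix : {w T : Str σ} → w ≼ T → w ∈ Prefix T
≼⇒Prefix (r , refl) = Pre.fromView (≡⇒Pointwise-≡ refl Pre.++ r)

Suffix⇒≽ : {w T : Str σ} → w ∈ Suffix T → w ≽ T
Suffix⇒≽ i with Suf.toView i
... | l Suf.++ p with refl ← Pointwise-≡⇒≡ p = l , refl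

≽⇒Suffix : {w T : Str σ} → w ≽ T → w ∈ Suffix T
≽⇒Suffix (l , refl) = Suf.fromView (l Suf.++ ≡⇒Pointwise-≡ refl)

-- Maximal strings and maximal extensions

LMax RMax : Str σ → Str σ → Set
LMax T w = w ≼ T ⊎ ∃₂ λ a b → a ≢ b × a ∷ w ⊑ T × b ∷ w ⊑ T
RMax T w = w ≽ T ⊎ ∃₂ λ a b → a ≢ b × w ∷ʳ a ⊑ T × w ∷ʳ b ⊑ T

LMax⇒⊑ : {T w : Str σ} → LMax T w → w ⊑ T
LMax⇒⊑ (inj₁ p) = ≼⇒⊑ p
LMax⇒⊑ (inj₂ (_ , _ , _ , aw , _)) = ⊑-trans (≽⇒⊑ w≽a∷w) aw

RMax⇒⊑ : {T w : Str σ} → RMax T w → w ⊑ T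
RMax⇒⊑ (inj₁ p) = ≽⇒⊑ p
RMax⇒⊑ (inj₂ (_ , _ , _ , wa , _)) = ⊑-trans (≼⇒⊑ w≼w∷ʳa) wa

LeftM⇒LMax : {T w : Str σ} → w ∈ LeftM T → LMax T w
LeftM⇒LMax (_ , inj₁ p) = inj₁ (Prefix⇒≼ p)
LeftM⇒LMax (_ , inj₂ (a , b , a≢b , p , q)) = inj₂ (a , b , a≢b , Substr⇒⊑ p , Substr⇒⊑ q)

LMax⇒LeftM : {T w : Str σ} → LMax T w → w ∈ LeftM T
LMax⇒LeftM m = ⊑⇒Substr (LMax⇒⊑ m) , [ inj₁ ∘ ≼⇒Prefix
  , (λ (a , b , a≢b , p , q) → inj₂ (a , b , a≢b , ⊑⇒Substr p , ⊑⇒Substr q)) ]′ m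

RightM⇒RMax : {T w : Str σ} → w ∈ RightM T → RMax T w
RightM⇒RMax (_ , inj₁ p) = inj₁ (Suffix⇒≽ p)
RightM⇒RMax (_ , inj₂ (a , b , a≢b , p , q)) = inj₂ (a , b , a≢b , Substr⇒⊑ p , Substr⇒⊑ q)

RMax⇒RightM : {T w : Str σ} → RMax T w → w ∈ RightM T
RMax⇒RightM m = ⊑⇒Substr (RMax⇒⊑ m) , [ inj₁ ∘ ≽⇒Suffix
  , (λ (a , b , a≢b , p , q) → inj₂ (a , b , a≢b , ⊑⇒Substr p , ⊑⇒Substr q)) ]′ m

lMax? : (T w : Str σ) → Dec (LMax T w)
lMax? T w = map′ LeftM⇒LMax LMax⇒LeftM (leftM? T w)

rMax? : (T w : Str σ) → Dec (RMax T w)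
rMax? T w = map′ RightM⇒RMax RMax⇒RightM (rightM? T w)

_⊑?_ : (w T : Str σ) → Dec (w ⊑ T)
w ⊑? T = map′ Substr⇒⊑ ⊑⇒Substr (substr? T w)

_≼?_ : (w T : Str σ) → Dec (w ≼ T)
w ≼? T = map′ Prefix⇒≼ ≼⇒Prefix (prefix? Fin._≟_ w T)

LMax-≼ : {T w t : Str σ} → w ≼ t → LMax T t → LMax T w
LMax-≼ w≼t (inj₁ t≼T) = inj₁ (≼-trans w≼t t≼T)
LMax-≼ w≼t (inj₂ (a , b , a≢b , at , bt)) = inj₂ (a , b , a≢b ,
  ⊑-trans (≼⇒⊑ (++-≼ (a ∷ []) w≼t)) at , ⊑-trans (≼⇒⊑ (++-≼ (b ∷ []) w≼t)) bt)

RMax-≽ : {T w t : Str σ} → w ≽ t → RMax T t → RMax T w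
RMax-≽ w≽t (inj₁ t≽T) = inj₁ (≽-trans w≽t t≽T)
RMax-≽ {w = w} (l , refl) (inj₂ (a , b , a≢b , ta , tb)) = inj₂ (a , b , a≢b ,
  ⊑-trans (≽⇒⊑ (l , sym (++-assoc l w (a ∷ [])))) ta ,
  ⊑-trans (≽⇒⊑ (l , sym (++-assoc l w (b ∷ [])))) tb)

-- α x β is the maximal extension of x in T.
record Closure (T x α β : Str σ) : Set where
  field
    lMax   : LMax T (α ++ x ++ β)
    rMax   : RMax T (α ++ x ++ β)
    extend : ∀ l r → l ++ x ++ r ≡ T → α ≽ l × β ≼ r

  extend′ : ∀ {l r} → l ++ x ++ r ≡ T →
            ∃₂ λ l′ r′ → l ≡ l′ ++ α × r ≡ β ++ r′ × l′ ++ (α ++ x ++ β) ++ r′ ≡ T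
  extend′ {l} {r} e with (l′ , refl) , (r′ , refl) ← extend l r e =
    l′ , r′ , refl , refl , trans (cong (l′ ++_) (++-assoc₄ α x β)) (trans (sym (++-assoc l′ α _)) e)

module _ {T : Str σ} where

  ¬LMax⇒left : ∀ {z} → z ⊑ T → ¬ LMax T z → ∃ λ b → ∀ l r → l ++ z ++ r ≡ T → b ∷ [] ≽ l
  ¬LMax⇒left {z} (l₀ , r₀ , e₀) ¬m with initLast l₀
  ... | [] = contradiction (inj₁ (r₀ , e₀)) ¬m
  ... | l₀ ∷ʳ′ b = b , other
    where
    other : ∀ l r → l ++ z ++ r ≡ T → b ∷ [] ≽ l
    other l r e with initLast l
    ... | [] = contradiction (inj₁ (r , e)) ¬m
    ... | l ∷ʳ′ b′ with b Fin.≟ b′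
    ...   | yes refl = l , refl
    ...   | no b≢b′ = contradiction (inj₂ (b , b′ , b≢b′ ,
              (l₀ , r₀ , trans (sym (∷ʳ-++ l₀ b _)) e₀) , (l , r , trans (sym (∷ʳ-++ l b′ _)) e))) ¬m

  ¬RMax⇒right : ∀ {z} → z ⊑ T → ¬ RMax T z → ∃ λ b → ∀ l r → l ++ z ++ r ≡ T → b ∷ [] ≼ r
  ¬RMax⇒right {z} (l₀ , [] , e₀) ¬m =
    contradiction (inj₁ (l₀ , trans (cong (l₀ ++_) (sym (++-identityʳ z))) e₀)) ¬m
  ¬RMax⇒right {z} (l₀ , b ∷ r₀ , e₀) ¬m = b , other
    where
    other : ∀ l r → l ++ z ++ r ≡ T → b ∷ [] ≼ r
    other l [] e = contradiction (inj₁ (l , trans (cong (l ++_) (sym (++-identityʳ z))) e)) ¬m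
    other l (b′ ∷ r) e with b Fin.≟ b′
    ... | yes refl = r , refl
    ... | no b≢b′ = contradiction (inj₂ (b , b′ , b≢b′ , ⊑-∷ʳ l₀ z e₀ , ⊑-∷ʳ l z e)) ¬m

  -- While the string is not maximal on some side, the letter next to it there is the same at all
  -- its occurrences and gets appended. The fuel `n` bounds the remaining growth, since the
  -- extension stays a factor of `T`.
  closure : ∀ {x} → x ⊑ T → ∃₂ (Closure T x)
  closure {x} x⊑T = go (length T) [] [] (subst (_⊑ T) (sym (++-identityʳ x)) x⊑T)
      (ℕ.m≤m+n _ _) (λ l r _ → (l , ++-identityʳ l) , (r , refl))
    where
    go : ∀ n α β → α ++ x ++ β ⊑ T → length T ≤ n + length (α ++ x ++ β) →
         (∀ l r → l ++ x ++ r ≡ T → α ≽ l × β ≼ r) → ∃₂ (Closure T x)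
    stepˡ : ∀ n α β → α ++ x ++ β ⊑ T → length T ≤ n + length (α ++ x ++ β) →
         (∀ l r → l ++ x ++ r ≡ T → α ≽ l × β ≼ r) →
         (∃ λ b → ∀ l r → l ++ (α ++ x ++ β) ++ r ≡ T → b ∷ [] ≽ l) → ∃₂ (Closure T x)
    stepʳ : ∀ n α β → α ++ x ++ β ⊑ T → length T ≤ n + length (α ++ x ++ β) →
         (∀ l r → l ++ x ++ r ≡ T → α ≽ l × β ≼ r) →
         (∃ λ b → ∀ l r → l ++ (α ++ x ++ β) ++ r ≡ T → b ∷ [] ≼ r) → ∃₂ (Closure T x)

    assoc : ∀ l α β r → l ++ (α ++ x ++ β) ++ r ≡ (l ++ α) ++ x ++ β ++ r
    assoc l α β r = trans (cong (l ++_) (++-assoc₄ α x β)) (sym (++-assoc l α _))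

    go n α β z⊑T n≥ ext with lMax? T (α ++ x ++ β)
    ... | no ¬m = stepˡ n α β z⊑T n≥ ext (¬LMax⇒left z⊑T ¬m)
    ... | yes lm with rMax? T (α ++ x ++ β)
    ...   | yes rm = α , β , record { lMax = lm ; rMax = rm ; extend = ext }
    ...   | no ¬m  = stepʳ n α β z⊑T n≥ ext (¬RMax⇒right z⊑T ¬m)

    stepˡ n α β (l , r , e) n≥ ext (b , before) with before l r e
    ... | l′ , refl = next n n≥
      where
      bz⊑T : b ∷ (α ++ x ++ β) ⊑ T
      bz⊑T = l′ , r , trans (sym (∷ʳ-++ l′ b _)) e
      next : ∀ n → length T ≤ n + length (α ++ x ++ β) → ∃₂ (Closure T x)
      next zero n≥ = contradiction (≤-trans (⊑-length bz⊑T) n≥) (ℕ.<-irrefl refl)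
      next (suc n) n≥ = go n (b ∷ α) β bz⊑T
        (≤-trans n≥ (≤-reflexive (sym (ℕ.+-suc n _))))
        λ l r e → let (l₁ , el) , (r₁ , er) = ext l r e
                      l₂ , e₂ = before l₁ r₁ (trans (assoc l₁ α β r₁)
                                  (trans (cong₂ (λ p q → p ++ x ++ q) el er) e))
                  in (l₂ , trans (sym (∷ʳ-++ l₂ b _)) (trans (cong (_++ α) e₂) el)) , (r₁ , er)

    stepʳ n α β (l , r , e) n≥ ext (b , after) with after l r e
    ... | r′ , refl = next n n≥
      where
      zb : ∀ {r} → α ++ x ++ β ++ b ∷ r ≡ (α ++ x ++ β ∷ʳ b) ++ r
      zb {r} = trans (cong (λ t → α ++ x ++ t) (sym (∷ʳ-++ β b _))) (sym (++-assoc₄ α x (β ∷ʳ b)))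
      bz⊑T : α ++ x ++ β ∷ʳ b ⊑ T
      bz⊑T = l , r′ , trans (cong (l ++_) (trans (sym zb) (sym (++-assoc₄ α x β)))) e
      len : length (α ++ x ++ β ∷ʳ b) ≡ suc (length (α ++ x ++ β))
      len = trans (cong length (trans (cong (α ++_) (sym (++-assoc x β _))) (sym (++-assoc α (x ++ β) _))))
              (trans (length-++ (α ++ x ++ β)) (ℕ.+-comm _ 1))
      next : ∀ n → length T ≤ n + length (α ++ x ++ β) → ∃₂ (Closure T x)
      next zero n≥ = contradiction (≤-trans (≤-trans (≤-reflexive (sym len)) (⊑-length bz⊑T)) n≥) (ℕ.<-irrefl refl)
      next (suc n) n≥ = go n α (β ∷ʳ b) bz⊑T
        (≤-trans n≥ (≤-reflexive (sym (trans (cong (λ m → n + m) len) (ℕ.+-suc n _)))))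
        λ l r e → let (l₁ , el) , (r₁ , er) = ext l r e
                      r₂ , e₂ = after l₁ r₁ (trans (assoc l₁ α β r₁)
                                  (trans (cong₂ (λ p q → p ++ x ++ q) el er) e))
                  in (l₁ , el) , (r₂ , trans (∷ʳ-++ β b _) (trans (cong (β ++_) e₂) er))

  module _ {x α β} (C : Closure T x α β) where
    open Closure C

    private
      z : Str σ
      z = α ++ x ++ β

    closure-⊑ : z ⊑ T
    closure-⊑ = LMax⇒⊑ lMax

    private
      -- The `x` that follows `α′` inside one occurrence of `z` lies behind `α` in another, possibly
      -- different, occurrence of `z`.
      shift : ∀ α′ β′ → α′ ++ x ++ β′ ≡ z → ∀ l r → l ++ z ++ r ≡ T →
              ∃₂ λ l′ r′ → l ++ α′ ≡ l′ ++ α × β′ ++ r ≡ β ++ r′ × l′ ++ z ++ r′ ≡ T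
      shift α′ β′ e l r q = extend′
        (trans (++-assoc l α′ _) (trans (cong (l ++_) (trans (sym (++-assoc₄ α′ x β′)) (cong (_++ r) e))) q))

      |++| : ∀ (a {b} c {e} : Str σ) → a ++ b ≡ c ++ e → length a + length b ≡ length c + length e
      |++| a c q = trans (sym (length-++ a)) (trans (cong length q) (length-++ c))

      |++|′ : ∀ (a {b} c {e} : Str σ) → a ++ b ≡ c ++ e → length b + length a ≡ length e + length c
      |++|′ a {b} c {e} q = trans (ℕ.+-comm (length b) _) (trans (|++| a c q) (ℕ.+-comm (length c) _))

      cross : ∀ a b c e → a + b ≡ c + e → b < e → c < a
      cross a b c e q b<e = ℕ.≰⇒> λ a≤c → ℕ.<-irrefl q (ℕ.+-mono-≤-< a≤c b<e)

      -- Descent: with `α′` shorter than `α`, each shift strictly shortens the left context `l`,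
      -- whose length is bounded by `n`.
      noEarlier : ∀ n α′ β′ → α′ ++ x ++ β′ ≡ z → length α′ < length α →
                  ∀ l r → length l ≤ n → l ++ z ++ r ≡ T → ⊥
      noEarlier n α′ β′ e lt l r l≤n q with l′ , r′ , el , _ , q′ ← shift α′ β′ e l r q
        with l′<l ← cross (length l) _ (length l′) _ (|++| l l′ el) lt | n
      ... | zero  = ℕ.n≮0 (ℕ.<-≤-trans l′<l l≤n)
      ... | suc n = noEarlier n α′ β′ e lt l′ r′ (s≤s⁻¹ (≤-trans l′<l l≤n)) q′

      noLater : ∀ n α′ β′ → α′ ++ x ++ β′ ≡ z → length β′ < length β →
                ∀ l r → length r ≤ n → l ++ z ++ r ≡ T → ⊥
      noLater n α′ β′ e lt l r r≤n q with l′ , r′ , _ , er , q′ ← shift α′ β′ e l r q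
        with r′<r ← cross (length r) _ (length r′) _ (|++|′ β′ β er) lt | n
      ... | zero  = ℕ.n≮0 (ℕ.<-≤-trans r′<r r≤n)
      ... | suc n = noLater n α′ β′ e lt l′ r′ (s≤s⁻¹ (≤-trans r′<r r≤n)) q′

      later : ∀ α′ β′ → α′ ++ x ++ β′ ≡ z → length α < length α′ → length β′ < length β
      later α′ β′ e lt = ℕ.+-cancelˡ-< (length x) _ _ (subst₂ _<_ (length-++ x) (length-++ x)
        (cross (length (x ++ β)) _ (length (x ++ β′)) _ (sym (|++|′ α′ α e)) lt))

    -- A second occurrence of x in its closure would shift every occurrence of the
    -- closure, always in the same direction.
    closure-once : ∀ α′ {β′} → α′ ++ x ++ β′ ≡ z → α′ ≡ α × β′ ≡ β
    closure-once α′ {β′} e with l , r , q ← closure-⊑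
      with α′≡α , xβ ← ++-length-cancel α′ α e (ℕ.≤-antisym
           (ℕ.≮⇒≥ λ lt → noLater (length r) α′ β′ e (later α′ β′ e lt) l r ≤-refl q)
           (ℕ.≮⇒≥ λ lt → noEarlier (length l) α′ β′ e lt l r ≤-refl q))
      = α′≡α , ++-cancelˡ x _ _ xβ

    -- `α` ends every left context of `x`: an empty context leaves it empty, and two different
    -- preceding letters cannot both be its last letter.
    closure-LMax : LMax T x → α ≡ []
    closure-LMax m = ¬∷ʳ⇒[] α (nonempty m)
      where
      nonempty : LMax T x → ∀ α′ b → α ≢ α′ ∷ʳ b
      nonempty (inj₁ (r , e)) α′ b refl
        with () ← ++-conicalʳ α′ (b ∷ []) (++-conicalʳ (proj₁ (proj₁ (extend [] r e))) _ (proj₂ (proj₁ (extend [] r e))))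
      nonempty (inj₂ (a , a′ , a≢a′ , aw , a′w)) α′ b refl = a≢a′ (trans (last aw) (sym (last a′w)))
        where
        last : ∀ {a} → a ∷ x ⊑ T → a ≡ b
        last {a} (l , r , e) with l′ , q ← proj₁ (extend (l ∷ʳ a) r (trans (∷ʳ-++ l a _) e)) =
          ∷ʳ-injectiveʳ l (l′ ++ α′) (sym (trans (++-assoc l′ α′ _) q))

    closure-RMax : RMax T x → β ≡ []
    closure-RMax m = ¬∷⇒[] β (nonempty m)
      where
      nonempty : RMax T x → ∀ b β′ → β ≢ b ∷ β′
      nonempty (inj₁ (l , e)) b β′ refl
        with () ← proj₂ (proj₂ (extend l [] (trans (cong (l ++_) (++-identityʳ x)) e)))
      nonempty (inj₂ (a , a′ , a≢a′ , xa , xa′)) b β′ refl = a≢a′ (trans (first xa) (sym (first xa′)))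
        where
        first : ∀ {a} → x ∷ʳ a ⊑ T → a ≡ b
        first {a} xa with l , r , e ← ∷ʳ-⊑ x xa with r′ , q ← proj₂ (extend l (a ∷ r) e) =
          sym (∷-injectiveˡ q)

  -- Two occurrences preceded by different letters cannot both end where `T` ends. Hence every
  -- maximal extension other than `T` has an outgoing edge to charge.
  LMax⇒≡⊎⊏ : ∀ {z} → LMax T z → z ≡ T ⊎ ∃ λ a → z ∷ʳ a ⊑ T
  LMax⇒≡⊎⊏ {z} (inj₁ ([] , e))    = inj₁ (trans (sym (++-identityʳ z)) e)
  LMax⇒≡⊎⊏ {z} (inj₁ (a ∷ r , e)) = inj₂ (a , ⊑-∷ʳ [] z e)
  LMax⇒≡⊎⊏ {z} (inj₂ (b , b′ , _ , (l , a ∷ r , e) , _)) = inj₂ (a , ⊑-∷ʳ (l ∷ʳ b) z (trans (∷ʳ-++ l b _) e))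
  LMax⇒≡⊎⊏ {z} (inj₂ (b , b′ , _ , _ , (l , a ∷ r , e))) = inj₂ (a , ⊑-∷ʳ (l ∷ʳ b′) z (trans (∷ʳ-++ l b′ _) e))
  LMax⇒≡⊎⊏ {z} (inj₂ (b , b′ , b≢b′ , (l , [] , e) , (l′ , [] , e′))) =
    contradiction (∷ʳ-injectiveʳ l l′ (++-cancelʳ (z ++ []) _ _
      (trans (∷ʳ-++ l b _) (trans (trans e (sym e′)) (sym (∷ʳ-++ l′ b′ _)))))) b≢b′

-- Comparison by length and overlapping occurrences.

≽-antisym-length : {a b t : List A} → a ≽ t → b ≽ t → length a ≡ length b → a ≡ b
≽-antisym-length a≽t b≽t eq with ≽-compare a≽t b≽t (≤-reflexive eq)
... | []    , q    = q
... | x ∷ l , refl = contradiction (≤-reflexive (sym eq)) (ℕ.<⇒≱ (s≤s (≽-length (l , refl))))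

length-∷ʳ : ∀ (w : List A) {a} → length (w ∷ʳ a) ≡ suc (length w)
length-∷ʳ w = trans (length-++ w) (ℕ.+-comm _ 1)

length-<-++-∷ : ∀ (w : List A) {a t} → length w < length (w ++ a ∷ t)
length-<-++-∷ w {a} {t} = subst (length w <_) (sym (length-++-sucʳ w a t)) (s≤s (length-++-≤ˡ w))

≽-∷-injective : ∀ {b b′} {w t : List A} → b ∷ w ≽ t → b′ ∷ w ≽ t → b ≡ b′
≽-∷-injective bw b′w = ∷-injectiveˡ (≽-antisym-length bw b′w refl)

≼-∷ʳ-injective : ∀ {a a′} (w : List A) {t} → w ∷ʳ a ≼ t → w ∷ʳ a′ ≼ t → a ≡ a′
≼-∷ʳ-injective w wa wa′ = ∷ʳ-injectiveʳ w w
  (≼-antisym-length wa wa′ (trans (length-∷ʳ w) (sym (length-∷ʳ w))))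

longest-≽ : ∀ {P : List A → Set} → Decidable P → ∀ u → (∃ λ p → p ≽ u × P p) →
            ∃ λ p → p ≽ u × P p × (∀ {q} → q ≽ u → P q → length q ≤ length p)
longest-≽ P? u e with P? u
longest-≽ P? u e | yes Pu = u , ([] , refl) , Pu , λ q≽u _ → ≽-length q≽u
longest-≽ P? u (.u , ([] , refl) , Pu) | no ¬Pu = contradiction Pu ¬Pu
longest-≽ P? (x ∷ u) (p , (.x ∷ l , refl) , Pp) | no ¬Pu
  with q , (l′ , e) , Pq , max ← longest-≽ P? u (p , (l , refl) , Pp) =
  q , (x ∷ l′ , cong (x ∷_) e) , Pq , λ where
    ([] , refl)    Pu → contradiction Pu ¬Pu
    (_ ∷ l , e)   Pr → max (l , ∷-injectiveʳ e) Pr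

-- With p = g h p₂ and p₁ = h p₂, the two inner occurrences of p force g h = h g,
-- and b₁, b₂ are the last letters of g and h.
left-letters : ∀ {u p p₁ p₂ w : List A} {b₁ b₂} → p ≽ u →
  b₁ ∷ p₁ ≽ u → b₂ ∷ p₂ ≽ u → length p₁ < length p → length p₂ < length p →
  p ≼ p₁ ++ w → p ≼ p₂ ++ w → b₁ ≡ b₂
left-letters {A = A} p≽u s₁ s₂ lt₁ lt₂ o₁ o₂ =
  [ (λ le → sym (ordered p≽u s₂ s₁ lt₂ lt₁ o₂ o₁ le)) , ordered p≽u s₁ s₂ lt₁ lt₂ o₁ o₂ ]′
  (ℕ.≤-total _ _)
  where
  ordered : ∀ {u p p₁ p₂ w : List A} {b₁ b₂} → p ≽ u →
    b₁ ∷ p₁ ≽ u → b₂ ∷ p₂ ≽ u → length p₁ < length p → length p₂ < length p →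
    p ≼ p₁ ++ w → p ≼ p₂ ++ w → length p₂ ≤ length p₁ → b₁ ≡ b₂
  ordered {p₁ = p₁} {p₂} {w} {b₁} {b₂} p≽u s₁ s₂ lt₁ lt₂ o₁ o₂ p₂≤p₁
    with ≽-compare s₂ s₁ (s≤s p₂≤p₁)
  ... | [] , refl = refl
  ... | _ ∷ h , refl with g , refl ← ≽-compare s₁ p≽u lt₁ =
    sym (∷ʳ-injectiveʳ (g′ ++ h) (h′ ++ g) (trans (++-assoc g′ h _) (trans gh≡hg (sym (++-assoc h′ g _)))))
    where
    g′ h′ : List A
    g′ = g ∷ʳ b₁
    h′ = h ∷ʳ b₂
    p≡ : g′ ++ h′ ++ p₂ ≡ g ++ b₁ ∷ h ++ b₂ ∷ p₂
    p≡ = trans (∷ʳ-++ g b₁ _) (cong (λ t → g ++ b₁ ∷ t) (∷ʳ-++ h b₂ p₂))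
    t≡ : h′ ++ p₂ ++ w ≡ (h ++ b₂ ∷ p₂) ++ w
    t≡ = trans (∷ʳ-++ h b₂ _) (sym (++-assoc h (b₂ ∷ p₂) w))
    gh≼ : g′ ++ h′ ≼ h′ ++ p₂ ++ w
    gh≼ = subst (g′ ++ h′ ≼_) (sym t≡)
      (≼-trans (p₂ , trans (++-assoc g′ h′ p₂) p≡) o₁)
    hg≼ : h′ ++ g′ ≼ h′ ++ p₂ ++ w
    hg≼ = ++-≼ h′ (≼-trans (h ++ b₂ ∷ p₂ , ∷ʳ-++ g b₁ _) o₂)
    gh≡hg : g′ ++ h′ ≡ h′ ++ g′
    gh≡hg = ≼-antisym-length gh≼ hg≼ (trans (length-++ g′)
      (trans (ℕ.+-comm (length g′) _) (sym (length-++ h′))))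

-- Counting edges

length-cartesianProduct : (xs : List A) (ys : List B) →
                          length (cartesianProduct xs ys) ≡ length xs * length ys
length-cartesianProduct []       ys = refl
length-cartesianProduct (x ∷ xs) ys = trans (length-++ (map (x ,_) ys))
  (cong₂ _+_ (length-map (x ,_) ys) (length-cartesianProduct xs ys))

length-filter-map : ∀ {P : B → Set} (P? : Decidable P) (f : A → B) xs →
                    length (filter P? (map f xs)) ≡ length (filter (P? ∘ f) xs)
length-filter-map P? f []       = refl
length-filter-map P? f (x ∷ xs) with does (P? (f x))
... | true  = cong suc (length-filter-map P? f xs)
... | false = length-filter-map P? f xs

-- A relation replaces a function because injectivity of the charging is argued from the evidence
-- attached to each target. Every target used is removed from `ys`.
pigeonhole : ∀ {R : A → B → Set} {xs ys} → Unique xs →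
  (∀ {x} → x ∈ˡ xs → ∃ λ y → y ∈ˡ ys × R x y) →
  (∀ {x x′ y} → R x y → R x′ y → x ≡ x′) → length xs ≤ length ys
pigeonhole {xs = []} _ _ _ = z≤n
pigeonhole {R = R} {x ∷ xs} (x∉xs ∷ uniq) f inj
  with y , y∈ys , Rxy ← f (here refl)
  with ys₁ , ys₂ , refl ← ∈-∃++ y∈ys =
  subst (suc (length xs) ≤_) (sym (length-++-sucʳ ys₁ y ys₂))
    (s≤s (pigeonhole uniq (λ x′∈ → avoid x′∈ (f (there x′∈))) inj))
  where
  avoid : ∀ {x′} → x′ ∈ˡ xs → (∃ λ y′ → y′ ∈ˡ ys₁ ++ y ∷ ys₂ × R x′ y′) →
          ∃ λ y′ → y′ ∈ˡ ys₁ ++ ys₂ × R x′ y′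
  avoid x′∈ (y′ , y′∈ , Rx′y′) with ∈-++⁻ ys₁ y′∈
  ... | inj₁ y′∈₁          = y′ , ∈-++⁺ˡ y′∈₁ , Rx′y′
  ... | inj₂ (here refl)   = contradiction (inj Rxy Rx′y′) (All.lookup x∉xs x′∈)
  ... | inj₂ (there y′∈₂)  = y′ , ∈-++⁺ʳ ys₁ y′∈₂ , Rx′y′

Edge : ℕ → Set
Edge σ = Str σ × Fin σ

edge? : (T : Str σ) → Decidable (λ ((x , a) : Edge σ) → x ∷ʳ a ∈ Substr T)
edge? T (x , a) = substr? T (x ∷ʳ a)

edges : Str σ → List (Edge σ)
edges {σ} T = filter (edge? T) (cartesianProduct (maximals T) (allFin σ))

length-edges : (T : Str σ) → length (edges T) ≡ size T
length-edges {σ} T = go (maximals T)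
  where
  go : ∀ xs → length (filter (edge? T) (cartesianProduct xs (allFin σ))) ≡ sum (map (D T) xs)
  go []       = refl
  go (x ∷ xs) = begin
    length (filter (edge? T) (map (x ,_) (allFin σ) ++ cartesianProduct xs (allFin σ)))
      ≡⟨ cong length (filter-++ (edge? T) (map (x ,_) (allFin σ)) _) ⟩
    length (filter (edge? T) (map (x ,_) (allFin σ)) ++ filter (edge? T) (cartesianProduct xs (allFin σ)))
      ≡⟨ length-++ (filter (edge? T) (map (x ,_) (allFin σ))) ⟩
    length (filter (edge? T) (map (x ,_) (allFin σ))) + length (filter (edge? T) (cartesianProduct xs (allFin σ)))
      ≡⟨ cong₂ _+_ (length-filter-map (edge? T) (x ,_) (allFin σ)) (go xs) ⟩
    D T x + sum (map (D T) xs) ∎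
    where open ≡-Reasoning

edges-unique : (T : Str σ) → Unique (edges T)
edges-unique {σ} T = Unique.filter⁺ (edge? T)
  (Unique.cartesianProduct⁺ (maximals-unique T) (Unique.allFin⁺ σ))

∈-edges⁺ : ∀ {T x : Str σ} {a} → LMax T x → RMax T x → x ∷ʳ a ⊑ T → (x , a) ∈ˡ edges T
∈-edges⁺ {T = T} {a = a} lm rm xa = ∈-filter⁺ (edge? T)
  (∈-cartesianProduct⁺ (Equivalence.from (∈-maximals T) (LMax⇒LeftM lm , RMax⇒RightM rm)) (∈-allFin a))
  (⊑⇒Substr xa)

∈-edges⁻ : ∀ {T x : Str σ} {a} → (x , a) ∈ˡ edges T → LMax T x × RMax T x × x ∷ʳ a ⊑ T
∈-edges⁻ {σ} {T} e∈
  with e∈′ , xa ← ∈-filter⁻ (edge? T) {xs = cartesianProduct (maximals T) (allFin σ)} e∈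
  with lm , rm ← Equivalence.to (∈-maximals T) (proj₁ (∈-cartesianProduct⁻ (maximals T) (allFin σ) e∈′)) =
  LeftM⇒LMax lm , RightM⇒RMax rm , Substr⇒⊑ xa

-- The charging argument

-- The hypothesis change says that v is not preceded by d in T. It is what makes
-- a prefix s of v left-maximal in T as soon as d s is old.
module Edited (u c v : Str σ) (d : Fin σ)
  (change : u ≢ [] → ¬ (d ∷ v ≽ u ++ c ++ v)) where

  T T′ : Str σ
  T  = u ++ c ++ v
  T′ = u ++ d ∷ v

  -- Old strings and occurrences across the edited letter.

  Old : Str σ → Set
  Old w = w ⊑ u ⊎ w ⊑ v

  old? : ∀ w → Dec (Old w)
  old? w = (w ⊑? u) ⊎-dec (w ⊑? v)

  v≽T : v ≽ T
  v≽T = u ++ c , ++-assoc u c v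

  Old⇒⊑ : ∀ {w} → Old w → w ⊑ T
  Old⇒⊑ (inj₁ w⊑u) = ⊑-trans w⊑u (≼⇒⊑ (_ , refl))
  Old⇒⊑ (inj₂ w⊑v) = ⊑-trans w⊑v (≽⇒⊑ v≽T)

  Old-⊑ : ∀ {w t} → w ⊑ t → Old t → Old w
  Old-⊑ w⊑t (inj₁ t⊑u) = inj₁ (⊑-trans w⊑t t⊑u)
  Old-⊑ w⊑t (inj₂ t⊑v) = inj₂ (⊑-trans w⊑t t⊑v)

  Crossing : Str σ → Set
  Crossing w = ∃₂ λ p s → p ≽ u × w ≡ p ++ d ∷ s × s ≼ v

  old-or-crossing : ∀ {w} → w ⊑ T′ → Old w ⊎ Crossing w
  old-or-crossing {w} (l , r , e) = go u l e (λ p≽u → p≽u)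
    where
    go : ∀ u′ l → l ++ w ++ r ≡ u′ ++ d ∷ v → (∀ {p} → p ≽ u′ → p ≽ u) → Old w ⊎ Crossing w
    go u′ [] e up with ℕ.≤-total (length w) (length u′)
    ... | inj₁ w≤u with k , refl , _ ← levi w u′ e w≤u =
            inj₁ (inj₁ (⊑-trans (≼⇒⊑ (k , refl)) (≽⇒⊑ (up ([] , refl)))))
    ... | inj₂ u≤w with levi u′ w (sym e) u≤w
    ...   | []    , refl , _ = inj₁ (inj₁ (subst (_⊑ u) (sym (++-identityʳ u′)) (≽⇒⊑ (up ([] , refl)))))
    ...   | _ ∷ s , refl , q with refl , q′ ← ∷-injective q =
            inj₂ (u′ , s , up ([] , refl) , refl , (r , sym q′))
    go []       (x ∷ l) e up = inj₁ (inj₂ (l , r , ∷-injectiveʳ e))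
    go (y ∷ u′) (x ∷ l) e up = go u′ l (∷-injectiveʳ e) (up ∘ λ (l′ , e′) → y ∷ l′ , cong (y ∷_) e′)

  new-crossing : ∀ {w} → ¬ Old w → w ⊑ T′ → Crossing w
  new-crossing ¬old w⊑T′ = [ (λ old → contradiction old ¬old) , (λ cr → cr) ]′ (old-or-crossing w⊑T′)

  crossing-≼ : ∀ p {s} → s ≼ v → p ++ d ∷ s ≼ p ++ d ∷ v
  crossing-≼ p (r , refl) = ++-≼ p (r , refl)

  new-≼ : ∀ {w p} → p ≽ u → w ≼ p ++ d ∷ v → ¬ Old w → ∃ λ s → w ≡ p ++ d ∷ s × s ≼ v
  new-≼ {w} {p} p≽u (r , e) ¬old with ℕ.≤-total (length w) (length p)
  ... | inj₁ w≤p with k , q , _ ← levi w p e w≤p =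
          contradiction (inj₁ (⊑-trans (≼⇒⊑ (k , sym q)) (≽⇒⊑ p≽u))) ¬old
  ... | inj₂ p≤w with levi p w (sym e) p≤w
  ...   | []    , refl , _ = contradiction (inj₁ (subst (_⊑ u) (sym (++-identityʳ p)) (≽⇒⊑ p≽u))) ¬old
  ...   | _ ∷ s , refl , q with refl , q′ ← ∷-injective q = s , refl , (r , sym q′)

  -- Suffixes of `u` and their kinds.

  -- b₀ is the letter before the suffix p of u, and p has another occurrence in T′,
  -- preceded by b ≠ b₀, that starts inside u and ends inside d v.
  Inner : Str σ → Set
  Inner p = ∃₂ λ b₀ b → ∃ λ p₂ → b₀ ≢ b × b₀ ∷ p ≽ u × b ∷ p₂ ≽ u ×
            length p₂ < length p × p ≼ p₂ ++ d ∷ v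

  -- Within each kind, p is determined by its maximal extension in T, but a single
  -- extension may come from one p of each kind.
  data Kind : Set where
    leftMaximal ofV inner : Kind

  HasKind : Kind → Str σ → Set
  HasKind leftMaximal p = LMax T p
  HasKind ofV         p = ¬ LMax T p × p ≼ v
  HasKind inner       p = ¬ LMax T p × Inner p

  -- If `p` is not left-maximal in `T`, it is no prefix of `T′`, and two letters precede it there,
  -- one of them a `b` for which `b p` is not old. That occurrence crosses `d`: either `b` is `d`
  -- itself and `p` begins `v`, or it starts inside `u` and `b` differs from `b₀`, since `b₀ p` is
  -- old.
  kind : ∀ {p} → p ≽ u → LMax T′ p → ∃ λ κ → HasKind κ p
  kind {p} p≽u m with lMax? T p
  ... | yes lm = leftMaximal , lm
  ... | no ¬lm = [ (λ q → ofV , ¬lm , q) , (λ q → inner , ¬lm , q) ]′ (go p≽u m)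
    where
    go : p ≽ u → LMax T′ p → p ≼ v ⊎ Inner p
    go p≽u (inj₁ p≼T′) = contradiction
      (inj₁ (≼-trans {t = u} (≼-compare p≼T′ (_ , refl) (≽-length p≽u)) (_ , refl))) ¬lm
    go (l , e) (inj₂ (b₁ , b₂ , b₁≢b₂ , bp₁ , bp₂)) with initLast l
    ... | [] = contradiction (inj₁ (subst (_≼ T) (sym e) (_ , refl))) ¬lm
    ... | l ∷ʳ′ b₀ with before bp₁ | before bp₂
      where
      b₀p : b₀ ∷ p ≽ u
      b₀p = l , trans (sym (∷ʳ-++ l b₀ p)) e
      before : ∀ {b} → b ∷ p ⊑ T′ → Old (b ∷ p) ⊎ (p ≼ v ⊎ Inner p)
      before bp with old-or-crossing bp
      ... | inj₁ old = inj₁ old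
      ... | inj₂ ([] , s , _ , refl , s≼v) = inj₂ (inj₁ s≼v)
      before {b} bp | inj₂ (_ ∷ p₂ , s , bp₂ , refl , s≼v) with b₀ Fin.≟ b
      ... | yes refl  = inj₁ (inj₁ (≽⇒⊑ b₀p))
      ... | no b₀≢b = inj₂ (inj₂ (b₀ , b , p₂ , b₀≢b , b₀p , bp₂ ,
              length-<-++-∷ p₂ ,
              crossing-≼ p₂ s≼v))
    ...   | inj₁ old₁ | inj₁ old₂ = contradiction (inj₂ (b₁ , b₂ , b₁≢b₂ , Old⇒⊑ old₁ , Old⇒⊑ old₂)) ¬lm
    ...   | inj₂ q    | _         = q
    ...   | _         | inj₂ q    = q

  ¬LMax⇒≢[] : ∀ {p} → ¬ LMax T p → p ≢ []
  ¬LMax⇒≢[] ¬lm refl = ¬lm (inj₁ (T , refl))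

  -- Longest old prefixes and suffixes.

  -- x is the longest old prefix of p d v.
  Stops : Str σ → Str σ → Set
  Stops p x = p ≽ u × p ≼ x × Old x × x ≼ p ++ d ∷ v ×
    (x ≡ p ++ d ∷ v ⊎ ∃ λ a → x ∷ʳ a ≼ p ++ d ∷ v × ¬ Old (x ∷ʳ a))

  stops-length : ∀ {p x y} → Stops p x → y ≼ p ++ d ∷ v → Old y → length y ≤ length x
  stops-length (_ , _ , _ , _ , inj₁ refl) y≼ _ = ≼-length y≼
  stops-length {x = x} (_ , _ , _ , _ , inj₂ (a , xa≼ , ¬old)) y≼ old = ℕ.≮⇒≥ λ lt →
    ¬old (Old-⊑ (≼⇒⊑ (≼-compare xa≼ y≼ (≤-trans (≤-reflexive (length-∷ʳ x)) lt))) old)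

  stops-unique : ∀ {p x y} → Stops p x → Stops p y → x ≡ y
  stops-unique s@(_ , _ , ox , x≼ , _) s′@(_ , _ , oy , y≼ , _) =
    ≼-antisym-length x≼ y≼ (ℕ.≤-antisym (stops-length s′ x≼ ox) (stops-length s y≼ oy))

  stops-fresh : ∀ {x a} → Old x → ¬ Old (x ∷ʳ a) → x ∷ʳ a ⊑ T′ →
                ∃ λ p → Stops p x × x ∷ʳ a ≼ p ++ d ∷ v
  stops-fresh {x} {a} old ¬old xa with p , s , p≽u , e , s≼v ← new-crossing ¬old xa =
    p , (p≽u , p≼x , old , ≼-trans w≼w∷ʳa xa≼ , inj₂ (a , xa≼ , ¬old)) , xa≼
    where
    xa≼ : x ∷ʳ a ≼ p ++ d ∷ v
    xa≼ = subst (_≼ p ++ d ∷ v) (sym e) (crossing-≼ p s≼v)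
    p≼x : p ≼ x
    p≼x = ≼-compare {t = x ∷ʳ a} (d ∷ s , sym e) w≼w∷ʳa (s≤s⁻¹
      (subst (length p <_) (trans (cong length (sym e)) (length-∷ʳ x)) (length-<-++-∷ p)))

  -- Right-maximality that is absent from `T` comes from `d`: either `x` is a suffix of `T′` longer
  -- than `v`, or one of its right extensions is not old.
  stops-¬RMax : ∀ {x} → Old x → RMax T′ x → ¬ RMax T x → ∃ λ p → Stops p x
  stops-¬RMax {x} old (inj₁ (l , e)) ¬rm with ℕ.≤-<-connex (length x) (length v)
  ... | inj₁ x≤v = contradiction (inj₁ (≽-trans (≽-compare (l , e) (u ∷ʳ d , ∷ʳ-++ u d v) x≤v) v≽T)) ¬rm
  ... | inj₂ v<x with k , q , refl ← levi-≽ u l (sym e) v<x =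
          k , (l , sym q) , (_ , refl) , old , ([] , ++-identityʳ _) , inj₁ refl
  stops-¬RMax {x} old (inj₂ (a , b , a≢b , xa , xb)) ¬rm with old? (x ∷ʳ a) | old? (x ∷ʳ b)
  ... | yes oa | yes ob = contradiction (inj₂ (a , b , a≢b , Old⇒⊑ oa , Old⇒⊑ ob)) ¬rm
  ... | no ¬oa | _ = let p , st , _ = stops-fresh old ¬oa xa in p , st
  ... | yes _ | no ¬ob = let p , st , _ = stops-fresh old ¬ob xb in p , st

  -- x is the longest old suffix of u d s.
  Starts : Str σ → Str σ → Set
  Starts s x = s ≼ v × s ≽ x × Old x × x ≽ u ++ d ∷ s ×
    (x ≡ u ++ d ∷ s ⊎ ∃ λ b → b ∷ x ≽ u ++ d ∷ s × ¬ Old (b ∷ x))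

  starts-length : ∀ {s x y} → Starts s x → y ≽ u ++ d ∷ s → Old y → length y ≤ length x
  starts-length (_ , _ , _ , _ , inj₁ refl) y≽ _ = ≽-length y≽
  starts-length {x = x} (_ , _ , _ , _ , inj₂ (b , bx≽ , ¬old)) y≽ old = ℕ.≮⇒≥ λ lt →
    ¬old (Old-⊑ (≽⇒⊑ (≽-compare bx≽ y≽ lt)) old)

  starts-unique : ∀ {s x y} → Starts s x → Starts s y → x ≡ y
  starts-unique s@(_ , _ , ox , x≽ , _) s′@(_ , _ , oy , y≽ , _) =
    ≽-antisym-length x≽ y≽ (ℕ.≤-antisym (starts-length s′ x≽ ox) (starts-length s y≽ oy))

  starts-fresh : ∀ {x b} → Old x → ¬ Old (b ∷ x) → b ∷ x ⊑ T′ → ∃ λ s → Starts s x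
  starts-fresh {x} {b} old ¬old bx with p , s , (l , e′) , e , s≼v ← new-crossing ¬old bx =
    s , s≼v , s≽x p e , old , ≽-trans w≽a∷w bx≽ , inj₂ (b , bx≽ , ¬old)
    where
    bx≽ : b ∷ x ≽ u ++ d ∷ s
    bx≽ = l , trans (cong (l ++_) e) (trans (sym (++-assoc l p _)) (cong (_++ d ∷ s) e′))
    s≽x : ∀ p → b ∷ x ≡ p ++ d ∷ s → s ≽ x
    s≽x []      refl = [] , refl
    s≽x (_ ∷ p) refl = p ∷ʳ d , ∷ʳ-++ p d s

  -- Mirror image of `stops-¬RMax`, with prefixes of `v` in place of suffixes of `u`.
  starts-¬LMax : ∀ {x} → Old x → LMax T′ x → ¬ LMax T x → ∃ λ s → Starts s x
  starts-¬LMax {x} old (inj₁ (r , e)) ¬lm with ℕ.≤-total (length x) (length u)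
  ... | inj₁ x≤u = contradiction (inj₁ (≼-trans {t = u} (≼-compare (r , e) (_ , refl) x≤u) (_ , refl))) ¬lm
  ... | inj₂ u≤x with levi u x (sym e) u≤x
  ...   | [] , refl , _ = contradiction (inj₁ (subst (_≼ T) (sym (++-identityʳ u)) (_ , refl))) ¬lm
  ...   | _ ∷ s , refl , q with refl , q′ ← ∷-injective q =
          s , (r , sym q′) , (u ∷ʳ d , ∷ʳ-++ u d s) , old , ([] , refl) , inj₁ refl
  starts-¬LMax {x} old (inj₂ (a , b , a≢b , ax , bx)) ¬lm with old? (a ∷ x) | old? (b ∷ x)
  ... | yes oa | yes ob = contradiction (inj₂ (a , b , a≢b , Old⇒⊑ oa , Old⇒⊑ ob)) ¬lm
  ... | no ¬oa | _      = starts-fresh old ¬oa ax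
  ... | yes _  | no ¬ob = starts-fresh old ¬ob bx

  -- Recovering a string from its maximal extension.

  IsClosure : Str σ → Str σ → Set
  IsClosure p z = ∃₂ λ α β → Closure T p α β × α ++ p ++ β ≡ z

  -- Let `e` end with `f`; then `f` is `b₀`, as both precede `p` in `u`. If `p₂` contains all of
  -- `e`, then `left-letters` makes `f` equal to `b`. Otherwise `d` falls inside the copy of `e`,
  -- and `α` carries this `d` to the place before `v`.
  inner-closure-injective : ∀ {e p α β α′} → e ++ p ≽ u → Inner p → Inner (e ++ p) →
    Closure T p α β → α′ ++ e ≡ α → e ≡ []
  inner-closure-injective {e} {p} {α} {β} {α′} ep≽u (b₀ , b , p₁ , b₀≢b , b₀p≽u , bp₁≽u , p₁<p , p≼)
    (_ , b′ , p₂ , _ , _ , b′p₂≽u , p₂<ep , (r , ep≼)) C α≡ = ¬∷ʳ⇒[] e nonempty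
    where
    nonempty : ∀ e₀ f → e ≢ e₀ ∷ʳ f
    nonempty e₀ f refl with ℕ.≤-<-connex (length e) (length p₂)
    ... | inj₁ e≤p₂ with p₃ , refl , q ← levi e p₂ (trans (sym (++-assoc e p r)) ep≼) e≤p₂ =
      b₀≢b (trans (≽-∷-injective b₀p≽u (≽-trans (e₀ , sym (∷ʳ-++ e₀ f p)) ep≽u))
        (sym (left-letters (≽-trans (e , refl) ep≽u) bp₁≽u
          (≽-trans (b′ ∷ e₀ , cong (b′ ∷_) (sym (∷ʳ-++ e₀ f p₃))) b′p₂≽u) p₁<p
          (ℕ.+-cancelˡ-< (length e) _ _ (subst₂ _<_ (length-++ e) (length-++ e) p₂<ep))
          p≼ (r , q))))
    ... | inj₂ p₂<e with levi p₂ e (trans (sym ep≼) (++-assoc e p r)) (ℕ.<⇒≤ p₂<e)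
    ...   | [] , e≡ , _ = contradiction (cong length (trans e≡ (++-identityʳ p₂))) (ℕ.>⇒≢ p₂<e)
    -- `p` occurs in `v` after `e₁`. There `α`, which ends with `p₂ d e₁`, must precede it, so `u c`
    -- ends with `d`, against `change`.
    ...   | _ ∷ e₁ , e≡ , q with refl , v≡ ← ∷-injective q
      with l , l≡ ← proj₁ (Closure.extend C (u ++ c ++ e₁) r
             (trans (++-assoc₄ u c e₁) (cong (λ t → u ++ c ++ t) (sym v≡)))) =
      change (λ { refl → contradiction (≽-length b₀p≽u) λ () }) (l ++ α′ ++ p₂ , dv≽T)
      where
      uc≡ : (l ++ α′ ++ p₂) ++ d ∷ [] ≡ u ++ c
      uc≡ = ++-cancelʳ e₁ _ _ (begin
        ((l ++ α′ ++ p₂) ++ d ∷ []) ++ e₁ ≡⟨ ∷ʳ-++ (l ++ α′ ++ p₂) d e₁ ⟩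
        (l ++ α′ ++ p₂) ++ d ∷ e₁         ≡⟨ ++-assoc₄ l α′ p₂ ⟩
        l ++ α′ ++ p₂ ++ d ∷ e₁           ≡⟨ cong (λ t → l ++ α′ ++ t) (sym e≡) ⟩
        l ++ α′ ++ e                      ≡⟨ cong (l ++_) α≡ ⟩
        l ++ α                            ≡⟨ l≡ ⟩
        u ++ c ++ e₁                      ≡⟨ sym (++-assoc u c e₁) ⟩
        (u ++ c) ++ e₁                    ∎)
        where open ≡-Reasoning
      dv≽T : (l ++ α′ ++ p₂) ++ d ∷ v ≡ T
      dv≽T = trans (sym (∷ʳ-++ (l ++ α′ ++ p₂) d v)) (trans (cong (_++ v) uc≡) (++-assoc u c v))

  -- If `p′ = e p` is the longer suffix, the single occurrence of `p` in its extension gives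
  -- `α = α′ e`, and each kind forces `e` to be empty.
  kind-injective : ∀ {κ p p′ z} → p ≽ u → p′ ≽ u → HasKind κ p → HasKind κ p′ →
                   IsClosure p z → IsClosure p′ z → p ≡ p′
  kind-injective p≽u p′≽u k k′ C C′ =
    [ ordered p≽u p′≽u k k′ C C′ , sym ∘ ordered p′≽u p≽u k′ k C′ C ]′ (ℕ.≤-total _ _)
    where
    ordered : ∀ {κ p p′ z} → p ≽ u → p′ ≽ u → HasKind κ p → HasKind κ p′ →
              IsClosure p z → IsClosure p′ z → length p ≤ length p′ → p ≡ p′
    ordered {κ} {p} p≽u p′≽u k k′ (α , β , C , z≡) (α′ , β′ , C′ , z′≡) p≤p′
      with e , refl ← ≽-compare p≽u p′≽u p≤p′ = cong (_++ p) (sym (empty κ k k′))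
      where
      α≡ : α′ ++ e ≡ α
      α≡ = proj₁ (closure-once C (α′ ++ e) (begin
        (α′ ++ e) ++ p ++ β′ ≡⟨ ++-assoc α′ e _ ⟩
        α′ ++ e ++ p ++ β′   ≡⟨ cong (α′ ++_) (sym (++-assoc e p β′)) ⟩
        α′ ++ (e ++ p) ++ β′ ≡⟨ trans z′≡ (sym z≡) ⟩
        α ++ p ++ β          ∎))
        where open ≡-Reasoning
      empty : ∀ κ → HasKind κ p → HasKind κ (e ++ p) → e ≡ []
      empty leftMaximal lm _ = ++-conicalʳ α′ e (trans α≡ (closure-LMax C lm))
      empty inner (_ , i) (_ , i′) = inner-closure-injective p′≽u i i′ C α≡
      -- `p` also begins `e p`, as both begin `v`, so its single occurrence gives `α = α′` as well.
      empty ofV (_ , p≼v) (_ , p′≼v) with k , q ← ≼-compare p≼v p′≼v p≤p′ =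
        ++-identityʳ-unique α′ (sym (trans α≡ (sym (proj₁ (closure-once C α′ (begin
          α′ ++ p ++ k ++ β′   ≡⟨ cong (α′ ++_) (sym (++-assoc p k β′)) ⟩
          α′ ++ (p ++ k) ++ β′ ≡⟨ cong (λ t → α′ ++ t ++ β′) q ⟩
          α′ ++ (e ++ p) ++ β′ ≡⟨ trans z′≡ (sym z≡) ⟩
          α ++ p ++ β          ∎))))))
        where open ≡-Reasoning

  -- If `z` began `v`, then `p` would begin `z`. Occurring only once there, it would be the start of
  -- its own left-maximal extension, hence left-maximal.
  ofV-closure-⋠ : ∀ {p z} → HasKind ofV p → IsClosure p z → ¬ z ≼ v
  ofV-closure-⋠ {p} (¬lm , p≼v) (α , β , C , refl) z≼v
    with k , q ← ≼-compare p≼v z≼v (⊑-length {w = p} (α , β , refl))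
    with refl , _ ← closure-once C [] q = ¬lm (LMax-≼ (β , refl) (Closure.lMax C))

  -- The end of `u` and the start of `v` are two different occurrences of `p` in `T`, whereas `p`
  -- occurs once in its extension. So no sink is reserved for this kind.
  ofV-closure-≢T : ∀ {p} → p ≽ u → HasKind ofV p → ¬ IsClosure p T
  ofV-closure-≢T {p} (l , e) (¬lm , (r , e′)) (α , β , C , z≡) =
    ¬LMax⇒≢[] ¬lm (++-conicalˡ p c (++-identityʳ-unique l (begin
      l            ≡⟨ proj₁ (closure-once C l (trans (sym (++-assoc l p _)) (trans (cong (_++ c ++ v) e) (sym z≡)))) ⟩
      α            ≡⟨ sym (proj₁ (closure-once C (u ++ c) (trans (++-assoc u c _) (trans (cong (λ t → u ++ c ++ t) e′) (sym z≡))))) ⟩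
      u ++ c       ≡⟨ cong (_++ c) (sym e) ⟩
      (l ++ p) ++ c ≡⟨ ++-assoc l p c ⟩
      l ++ p ++ c  ∎)))
    where open ≡-Reasoning

  -- New strings and their first crossing.

  record FirstCrossing (x p s : Str σ) : Set where
    field
      new   : ¬ Old x
      p≽u   : p ≽ u
      x≡    : x ≡ p ++ d ∷ s
      s≼v   : s ≼ v
      -- A longer suffix of `u` means an earlier start.
      first : ∀ {q} → q ≽ u → x ≼ q ++ d ∷ v → length q ≤ length p

    s≽x : s ≽ x
    s≽x = p ∷ʳ d , trans (∷ʳ-++ p d s) (sym x≡)

    p≼x : p ≼ x
    p≼x = d ∷ s , sym x≡

  firstCrossing : ∀ {x} → x ⊑ T′ → ¬ Old x → ∃₂ (FirstCrossing x)
  firstCrossing {x} x⊑T′ ¬old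
    with p₀ , s₀ , p₀≽u , refl , s₀≼v ← new-crossing ¬old x⊑T′
    with p , p≽u , x≼ , first ← longest-≽ (λ q → x ≼? (q ++ d ∷ v)) u (p₀ , p₀≽u , crossing-≼ p₀ s₀≼v)
    with s , x≡ , s≼v ← new-≼ p≽u x≼ ¬old =
    p , s , record { new = ¬old ; p≽u = p≽u ; x≡ = x≡ ; s≼v = s≼v ; first = first }

  new-before : ∀ {b x} → ¬ Old x → b ∷ x ⊑ T′ → ∃ λ q → b ∷ q ≽ u × x ≼ q ++ d ∷ v
  new-before ¬old bx with new-crossing (¬old ∘ Old-⊑ (≽⇒⊑ w≽a∷w)) bx
  ... | []    , s , _    , refl , s≼v = contradiction (inj₂ (≼⇒⊑ s≼v)) ¬old
  ... | _ ∷ q , s , bq≽u , refl , s≼v = q , bq≽u , crossing-≼ q s≼v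

  new-after : ∀ {x a} → ¬ Old x → x ∷ʳ a ⊑ T′ → ∃ λ q → q ≽ u × x ∷ʳ a ≼ q ++ d ∷ v
  new-after ¬old xa with q , s , q≽u , e , s≼v ← new-crossing (¬old ∘ Old-⊑ (≼⇒⊑ w≼w∷ʳa)) xa =
    q , q≽u , subst (_≼ q ++ d ∷ v) (sym e) (crossing-≼ q s≼v)

  module _ {x p s} (F : FirstCrossing x p s) where
    open FirstCrossing F

    -- An occurrence of `x` across `d` that starts no earlier than the first has at least `s` after
    -- `d`, so `s a` lies inside `v`.
    tail-extends : ∀ {a} → x ∷ʳ a ⊑ T′ → s ∷ʳ a ⊑ v
    tail-extends {a} xa with q , q≽u , xa≼ ← new-after new xa
      with t , e , t≼v ← new-≼ q≽u xa≼ (new ∘ Old-⊑ (≼⇒⊑ w≼w∷ʳa)) =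
      ⊑-trans (≽⇒⊑ (≽-compare sa≽xa (q ∷ʳ d , trans (∷ʳ-++ q d t) (sym e)) sa≤t)) (≼⇒⊑ t≼v)
      where
      xa≡ : p ++ d ∷ s ∷ʳ a ≡ x ∷ʳ a
      xa≡ = trans (sym (++-assoc p (d ∷ s) _)) (cong (_∷ʳ a) (sym x≡))
      sa≽xa : s ∷ʳ a ≽ x ∷ʳ a
      sa≽xa = p ∷ʳ d , trans (∷ʳ-++ p d _) xa≡
      sa≤t : length (s ∷ʳ a) ≤ length t
      sa≤t = ℕ.≮⇒≥ λ t<sa → ℕ.<-irrefl
        (trans (sym (length-++ q)) (trans (cong length (trans (sym e) (sym xa≡))) (length-++ p)))
        (ℕ.+-mono-≤-< (first q≽u (≼-trans w≼w∷ʳa xa≼)) (s≤s t<sa))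

    tail-RMax : RMax T′ x → RMax T s
    tail-RMax (inj₁ x≽T′) = inj₁ (≽-trans
      (≽-compare (≽-trans s≽x x≽T′) (u ∷ʳ d , ∷ʳ-++ u d v) (≼-length s≼v)) v≽T)
    tail-RMax (inj₂ (a , b , a≢b , xa , xb)) = inj₂ (a , b , a≢b ,
      ⊑-trans (tail-extends xa) (≽⇒⊑ v≽T) , ⊑-trans (tail-extends xb) (≽⇒⊑ v≽T))

    second-before : ∀ {b b′} → b ≢ b′ → b ∷ x ⊑ T′ → b′ ∷ p ≽ u →
                    ∃ λ q → b ∷ q ≽ u × length q < length p × x ≼ q ++ d ∷ v
    second-before b≢b′ bx b′p with q , bq≽u , x≼ ← new-before new bx
      with ℕ.m≤n⇒m<n∨m≡n (first (≽-trans w≽a∷w bq≽u) x≼)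
    ... | inj₁ q<p = q , bq≽u , q<p , x≼
    ... | inj₂ q≡p with refl ← ≽-antisym-length (≽-trans w≽a∷w bq≽u) p≽u q≡p =
      contradiction (≽-∷-injective bq≽u b′p) b≢b′

    -- Different letters next to `x` on one side belong to different occurrences, only one of which
    -- is the first. If `x` is both a prefix and a suffix of `T′`, these two occurrences differ,
    -- because `x a` occurs in `T′` and so `x` is not `T′`.
    second : LMax T′ x → RMax T′ x → ∀ {a} → x ∷ʳ a ⊑ T′ →
             ∃ λ q → q ≽ u × length q < length p × x ≼ q ++ d ∷ v
    second (inj₂ (b , b′ , b≢b′ , bx , b′x)) _ _
      with q , bq≽u , x≼ ← new-before new bx | q′ , b′q′≽u , x≼′ ← new-before new b′x
      with ℕ.m≤n⇒m<n∨m≡n (first (≽-trans w≽a∷w bq≽u) x≼)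
         | ℕ.m≤n⇒m<n∨m≡n (first (≽-trans w≽a∷w b′q′≽u) x≼′)
    ... | inj₁ q<p | _ = q , ≽-trans w≽a∷w bq≽u , q<p , x≼
    ... | inj₂ _ | inj₁ q′<p = q′ , ≽-trans w≽a∷w b′q′≽u , q′<p , x≼′
    ... | inj₂ q≡p | inj₂ q′≡p
      with refl ← ≽-antisym-length (≽-trans w≽a∷w bq≽u) (≽-trans w≽a∷w b′q′≽u) (trans q≡p (sym q′≡p)) =
      contradiction (≽-∷-injective bq≽u b′q′≽u) b≢b′
    second _ (inj₂ (b , b′ , b≢b′ , xb , xb′)) _
      with q , q≽u , xb≼ ← new-after new xb | q′ , q′≽u , xb′≼ ← new-after new xb′
      with ℕ.m≤n⇒m<n∨m≡n (first q≽u (≼-trans w≼w∷ʳa xb≼))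
         | ℕ.m≤n⇒m<n∨m≡n (first q′≽u (≼-trans w≼w∷ʳa xb′≼))
    ... | inj₁ q<p | _ = q , q≽u , q<p , ≼-trans w≼w∷ʳa xb≼
    ... | inj₂ _ | inj₁ q′<p = q′ , q′≽u , q′<p , ≼-trans w≼w∷ʳa xb′≼
    ... | inj₂ q≡p | inj₂ q′≡p
      with refl ← ≽-antisym-length q≽u q′≽u (trans q≡p (sym q′≡p)) =
      contradiction (≼-∷ʳ-injective x xb≼ xb′≼) b≢b′
    second (inj₁ x≼T′) (inj₁ (l , e)) xa with ℕ.≤-<-connex (length x) (length v)
    ... | inj₁ x≤v = contradiction (inj₂ (≽⇒⊑ (≽-compare (l , e) (u ∷ʳ d , ∷ʳ-++ u d v) x≤v))) new
    ... | inj₂ v<x with q , u≡ , x≡′ ← levi-≽ u l (sym e) v<x = q , (l , sym u≡) ,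
      ≤-trans (q<u l e u≡) (first ([] , refl) x≼T′) , ([] , trans (++-identityʳ x) x≡′)
      where
      q<u : ∀ l → l ++ x ≡ T′ → u ≡ l ++ q → length q < length u
      q<u []      refl _  = contradiction (⊑-length xa) (ℕ.<⇒≱ (≤-reflexive (sym (length-∷ʳ x))))
      q<u (_ ∷ l) _ refl = s≤s (≽-length (l , refl))

    -- In the second occurrence the part after `d` is longer than `s`, so `d s` occurs in `v`. The
    -- `s` that begins `v` is preceded in `T` by another letter, by `change`.
    tail-LMax : LMax T′ x → RMax T′ x → ∀ {a} → x ∷ʳ a ⊑ T′ → LMax T s
    tail-LMax lm rm xa with q , q≽u , q<p , x≼ ← second lm rm xa
      with t , e , t≼v ← new-≼ q≽u x≼ new = go (u ++ c) refl
      where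
      ds≽t : d ∷ s ≽ t
      ds≽t = ≽-compare (p , sym x≡) (q ∷ʳ d , trans (∷ʳ-++ q d t) (sym e)) (s≤s⁻¹ (ℕ.≰⇒> λ t≤s → ℕ.<-irrefl
        (trans (sym (length-++ q)) (trans (cong length (trans (sym e) x≡)) (length-++ p)))
        (ℕ.+-mono-<-≤ q<p t≤s)))
      ds⊑T : d ∷ s ⊑ T
      ds⊑T = ⊑-trans (≽⇒⊑ ds≽t) (⊑-trans (≼⇒⊑ t≼v) (≽⇒⊑ v≽T))
      u≢[] : u ≢ []
      u≢[] refl = contradiction (≤-trans q<p (≽-length p≽u)) λ ()
      split : ∀ w g → w ∷ʳ g ≡ u ++ c → w ++ g ∷ v ≡ T
      split w g w≡ = trans (sym (∷ʳ-++ w g v)) (trans (cong (_++ v) w≡) (++-assoc u c v))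
      go : ∀ w → w ≡ u ++ c → LMax T s
      go w w≡ with initLast w
      ... | [] = contradiction (++-conicalˡ u c (sym w≡)) u≢[]
      ... | w ∷ʳ′ g with g Fin.≟ d
      ...   | yes refl = contradiction (w , split w g w≡) (change u≢[])
      ...   | no g≢d   = inj₂ (g , d , g≢d ,
                ⊑-trans (≼⇒⊑ (++-≼ (g ∷ []) s≼v)) (≽⇒⊑ (w , split w g w≡)) , ds⊑T)

  -- Let `p′ = k p` with `k` ending in `b`. Then `x` is no prefix of `T′`, so some later crossing of
  -- `x` is preceded by a letter other than `b`. The second occurrence of `x′` contains a later
  -- crossing of `x` preceded by `b`, and `left-letters` gives a contradiction.
  tail-injective : ∀ {x p x′ p′ s a a′} → FirstCrossing x p s → FirstCrossing x′ p′ s →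
    LMax T′ x → RMax T′ x → x ∷ʳ a ⊑ T′ → LMax T′ x′ → RMax T′ x′ → x′ ∷ʳ a′ ⊑ T′ → x ≡ x′
  tail-injective F F′ lm rm xa lm′ rm′ x′a′ =
    [ ordered F F′ lm lm′ rm′ x′a′ , sym ∘ ordered F′ F lm′ lm rm xa ]′ (ℕ.≤-total _ _)
    where
    ordered : ∀ {x p x′ p′ s a′} → FirstCrossing x p s → FirstCrossing x′ p′ s →
      LMax T′ x → LMax T′ x′ → RMax T′ x′ → x′ ∷ʳ a′ ⊑ T′ → length p ≤ length p′ → x ≡ x′
    ordered {x} {p} {x′} {s = s} F F′ lm lm′ rm′ x′a′ p≤p′
      with FirstCrossing.x≡ F | FirstCrossing.x≡ F′ | ≽-compare (FirstCrossing.p≽u F) (FirstCrossing.p≽u F′) p≤p′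
    ... | refl | refl | k , refl = cong (λ t → t ++ d ∷ s) (cong (_++ p) (sym (¬∷ʳ⇒[] k nonempty)))
      where
      nonempty : ∀ k₀ b → k ≢ k₀ ∷ʳ b
      nonempty k₀ b refl = clash lm
        where
        bp≽u : b ∷ p ≽ u
        bp≽u = ≽-trans (k₀ , sym (∷ʳ-++ k₀ b p)) (FirstCrossing.p≽u F′)
        again : ∃ λ q → b ∷ q ≽ u × length q < length p × x ≼ q ++ d ∷ v
        again with q , q≽u , q<kp , (r , e) ← second F′ lm′ rm′ x′a′
          with e′ ← trans (sym (trans (cong (_++ r) (++-assoc k p _)) (++-assoc k x r))) e
          with ℕ.≤-<-connex (length k) (length q)
        ... | inj₁ k≤q with q′ , refl , e″ ← levi k q e′ k≤q =
          q′ , ≽-trans (k₀ , sym (∷ʳ-++ k₀ b q′)) q≽u ,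
          ℕ.+-cancelˡ-< (length k) _ _ (subst₂ _<_ (length-++ k) (length-++ k) q<kp) , (r , e″)
        ... | inj₂ q<k with levi q k (sym e′) (ℕ.<⇒≤ q<k)
        ...   | [] , k≡ , _ = contradiction (cong length (trans k≡ (++-identityʳ q))) (ℕ.>⇒≢ q<k)
        -- Here `x` would lie inside `v` and be old.
        ...   | _ ∷ m , k≡ , e″ with refl , e‴ ← ∷-injective e″ =
          contradiction (inj₂ (m , r , sym e‴)) (FirstCrossing.new F)
        differ : ∀ {b′} → b′ ≢ b → ¬ b′ ∷ x ⊑ T′
        differ b′≢b b′x with q , b′q≽u , q<p , x≼ ← second-before F b′≢b b′x bp≽u
          with q′ , bq′≽u , q′<p , x≼′ ← again =
          b′≢b (left-letters (FirstCrossing.p≽u F) b′q≽u bq′≽u q<p q′<p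
            (≼-trans (FirstCrossing.p≼x F) x≼) (≼-trans (FirstCrossing.p≼x F) x≼′))
        clash : ¬ LMax T′ x
        clash (inj₁ x≼T′) = ℕ.<⇒≱ (≽-length bp≽u) (FirstCrossing.first F ([] , refl) x≼T′)
        clash (inj₂ (b₁ , b₂ , b₁≢b₂ , b₁x , b₂x)) with b₁ Fin.≟ b
        ... | no b₁≢b  = differ b₁≢b b₁x
        ... | yes refl = differ (b₁≢b₂ ∘ sym) b₂x

  -- Charges and their targets.

  data Age : Set where
    fresh stale : Age

  -- Two plain tags and the six pairs of age and kind number the eight copies of the edges of `T`.
  data Tag : Set where
    kept extended : Tag
    node          : Age → Kind → Tag

  tags : List Tag
  tags = kept ∷ extended
       ∷ node fresh leftMaximal ∷ node fresh ofV ∷ node fresh inner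
       ∷ node stale leftMaximal ∷ node stale ofV ∷ node stale inner ∷ []

  ∈-tags : ∀ t → t ∈ˡ tags
  ∈-tags kept                     = here refl
  ∈-tags extended                 = there (here refl)
  ∈-tags (node fresh leftMaximal) = there (there (here refl))
  ∈-tags (node fresh ofV)         = there (there (there (here refl)))
  ∈-tags (node fresh inner)       = there (there (there (there (here refl))))
  ∈-tags (node stale leftMaximal) = there (there (there (there (there (here refl)))))
  ∈-tags (node stale ofV)         = there (there (there (there (there (there (here refl))))))
  ∈-tags (node stale inner)       = there (there (there (there (there (there (there (here refl)))))))

  -- For old `x`, `fresh` serves when `x a` is not old, and `stale` when `x a` is old but `x` is not
  -- right-maximal in `T`. Either condition leaves one letter `a` for given `p` and `x`.
  Next : Age → Str σ → Str σ → Fin σ → Set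
  Next fresh p x a = x ∷ʳ a ≼ p ++ d ∷ v
  Next stale p x a = ¬ RMax T x × x ∷ʳ a ⊑ T

  next-unique : ∀ ag {p x a b} → Next ag p x a → Next ag p x b → a ≡ b
  next-unique fresh {x = x} xa xb = ≼-∷ʳ-injective x xa xb
  next-unique stale {a = a} {b} (¬rm , xa) (_ , xb) with a Fin.≟ b
  ... | yes a≡b = a≡b
  ... | no  a≢b = contradiction (inj₂ (a , b , a≢b , xa , xb)) ¬rm

  record NodeCharge (ag : Age) (κ : Kind) (e : Edge σ) (z : Str σ) : Set where
    field
      p       : Str σ
      stops   : Stops p (proj₁ e)
      hasKind : HasKind κ p
      closed  : IsClosure p z
      next    : Next ag p (proj₁ e) (proj₂ e)

  nodeCharge-injective : ∀ {ag κ e e′ z} → NodeCharge ag κ e z → NodeCharge ag κ e′ z → e ≡ e′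
  nodeCharge-injective {ag} {κ}
    record { p = p ; stops = st ; hasKind = k ; closed = C ; next = n }
    record { p = p′ ; stops = st′ ; hasKind = k′ ; closed = C′ ; next = n′ }
    with refl ← kind-injective {κ} (proj₁ st) (proj₁ st′) k k′ C C′
    with refl ← stops-unique st st′
    with refl ← next-unique ag n n′ = refl

  -- With `s′ = s k`, the single occurrence of `s` makes `β` begin with `k`, and right-maximality of
  -- `s` makes `β` empty.
  prefix-closure-injective : ∀ {s s′ z} → s ≼ v → s′ ≼ v → RMax T s → RMax T s′ →
                             IsClosure s z → IsClosure s′ z → s ≡ s′
  prefix-closure-injective s≼v s′≼v rm rm′ C C′ =
    [ ordered s≼v s′≼v rm C C′ , sym ∘ ordered s′≼v s≼v rm′ C′ C ]′ (ℕ.≤-total _ _)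
    where
    ordered : ∀ {s s′ z} → s ≼ v → s′ ≼ v → RMax T s → IsClosure s z → IsClosure s′ z → length s ≤ length s′ → s ≡ s′
    ordered {s} s≼v s′≼v rm (α , β , C , z≡) (α′ , β′ , C′ , z′≡) s≤s′
      with k , refl ← ≼-compare s≼v s′≼v s≤s′ = sym (trans (cong (s ++_) k≡[]) (++-identityʳ s))
      where
      k≡[] : k ≡ []
      k≡[] = ++-conicalˡ k β′ (trans (proj₂ (closure-once C α′
        (trans (cong (α′ ++_) (sym (++-assoc s k β′))) (trans z′≡ (sym z≡))))) (closure-RMax C rm))

  data Charge : Edge σ → (Tag × Edge σ) ⊎ (Age × Kind) → Set where
    kept : ∀ {e} → Charge e (inj₁ (kept , e))
    extended : ∀ {x a s z} → Starts s x → RMax T s → IsClosure s z → Charge (x , a) (inj₁ (extended , z , a))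
    -- The tag can be shared with node fresh ofV because s is a prefix of v, whereas the
    -- maximal extension of a p of kind ofV is not.
    new : ∀ {x a p s} → FirstCrossing x p s → LMax T′ x → RMax T′ x → x ∷ʳ a ⊑ T′ →
          Charge (x , a) (inj₁ (node fresh ofV , s , a))
    -- The tag and `z` already determine the charged edge, so `b` may be any letter that follows
    -- `z`.
    node : ∀ {ag κ e z b} → NodeCharge ag κ e z → Charge e (inj₁ (node ag κ , z , b))
    sink : ∀ {ag κ e} → NodeCharge ag κ e T → Charge e (inj₂ (ag , κ))

  charge-injective : ∀ {e e′ t} → Charge e t → Charge e′ t → e ≡ e′
  charge-injective kept kept = refl
  charge-injective (extended st rm C) (extended st′ rm′ C′)
    with refl ← prefix-closure-injective (proj₁ st) (proj₁ st′) rm rm′ C C′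
    with refl ← starts-unique st st′ = refl
  charge-injective (new F lm rm xa) (new F′ lm′ rm′ x′a)
    with refl ← tail-injective F F′ lm rm xa lm′ rm′ x′a = refl
  charge-injective (new F _ _ _) (node N) =
    contradiction (FirstCrossing.s≼v F) (ofV-closure-⋠ (NodeCharge.hasKind N) (NodeCharge.closed N))
  charge-injective (node N) (new F _ _ _) =
    contradiction (FirstCrossing.s≼v F) (ofV-closure-⋠ (NodeCharge.hasKind N) (NodeCharge.closed N))
  charge-injective (node N) (node N′) = nodeCharge-injective N N′
  charge-injective (sink N) (sink N′) = nodeCharge-injective N N′

  -- The maximal extension of p may be T itself, which has no outgoing edge to charge.
  sinks : List (Age × Kind)
  sinks = (fresh , leftMaximal) ∷ (fresh , inner) ∷ (stale , leftMaximal) ∷ (stale , inner) ∷ []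

  targets : List ((Tag × Edge σ) ⊎ (Age × Kind))
  targets = map inj₁ (cartesianProduct tags (edges T)) ++ map inj₂ sinks

  length-targets : length targets ≡ 8 * size T + 4
  length-targets = trans (length-++ (map inj₁ (cartesianProduct tags (edges T))))
    (cong (_+ 4) (trans (length-map inj₁ (cartesianProduct tags (edges T)))
      (trans (length-cartesianProduct tags (edges T)) (cong (8 *_) (length-edges T)))))

  Charged : Edge σ → Set
  Charged e = ∃ λ t → t ∈ˡ targets × Charge e t

  chargeEdge : ∀ {e t z a} → LMax T z → RMax T z → z ∷ʳ a ⊑ T → Charge e (inj₁ (t , z , a)) → Charged e
  chargeEdge {t = t} lm rm za ch =
    _ , ∈-++⁺ˡ (∈-map⁺ inj₁ (∈-cartesianProduct⁺ (∈-tags t) (∈-edges⁺ lm rm za))) , ch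

  chargeSink : ∀ ag κ {e} → NodeCharge ag κ e T → Charged e
  chargeSink ag κ N = _ , ∈-++⁺ʳ (map inj₁ (cartesianProduct tags (edges T))) (∈-map⁺ inj₂ (∈-sinks ag κ N)) , sink N
    where
    ∈-sinks : ∀ ag κ {e} → NodeCharge ag κ e T → (ag , κ) ∈ˡ sinks
    ∈-sinks fresh leftMaximal _ = here refl
    ∈-sinks fresh inner       _ = there (here refl)
    ∈-sinks stale leftMaximal _ = there (there (here refl))
    ∈-sinks stale inner       _ = there (there (there (here refl)))
    ∈-sinks _     ofV         N = contradiction (NodeCharge.closed N)
      (ofV-closure-≢T (proj₁ (NodeCharge.stops N)) (NodeCharge.hasKind N))

  chargeNode : ∀ ag {p x a} → Stops p x → LMax T′ x → Next ag p x a → Charged (x , a)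
  chargeNode ag {p} {x} st@(p≽u , p≼x , _) lm n
    -- As a prefix of the left-maximal `x`, `p` is left-maximal in `T′` and so has a kind.
    with κ , k ← kind p≽u (LMax-≼ p≼x lm)
    with α , β , C ← closure {T = T} {p} (⊑-trans (≽⇒⊑ p≽u) (≼⇒⊑ (_ , refl)))
    with LMax⇒≡⊎⊏ (Closure.lMax C)
  ... | inj₁ z≡T = chargeSink ag κ (record { stops = st ; hasKind = k ; closed = α , β , C , z≡T ; next = n })
  ... | inj₂ (b , zb) = chargeEdge {t = node ag κ} (Closure.lMax C) (Closure.rMax C) zb
          (node (record { stops = st ; hasKind = k ; closed = α , β , C , refl ; next = n }))

  charge : ∀ {x a} → LMax T′ x → RMax T′ x → x ∷ʳ a ⊑ T′ → Charged (x , a)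
  charge {x} {a} lm rm xa with old? x
  ... | no ¬old with p , s , F ← firstCrossing (LMax⇒⊑ lm) ¬old =
          chargeEdge {t = node fresh ofV} (tail-LMax F lm rm xa) (tail-RMax F rm)
            (⊑-trans (tail-extends F xa) (≽⇒⊑ v≽T)) (new F lm rm xa)
  ... | yes old with old? (x ∷ʳ a)
  ...   | no ¬old with p , st , xa≼ ← stops-fresh old ¬old xa = chargeNode fresh st lm xa≼
  ...   | yes oldxa with rMax? T x
  ...     | no ¬rm with p , st ← stops-¬RMax old rm ¬rm = chargeNode stale st lm (¬rm , Old⇒⊑ oldxa)
  ...     | yes rmT with lMax? T x
  ...       | yes lmT = chargeEdge lmT rmT (Old⇒⊑ oldxa) kept
  ...       | no ¬lm
    with s , st@(s≼v , (k , refl) , _) ← starts-¬LMax old lm ¬lm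
    -- The suffix `s` of `x` inherits right-maximality in `T`, so its maximal extension grows only
    -- to the left.
    with rms ← RMax-≽ (k , refl) rmT
    with α , β , C ← closure {T = T} {s} (RMax⇒⊑ rms)
    with refl ← closure-RMax C rms =
      chargeEdge (Closure.lMax C) (Closure.rMax C) za (extended st rms (α , [] , C , refl))
      where
      -- `α` precedes every occurrence of `s`, so the `a` that follows `x` also follows `α s`.
      za : (α ++ s ++ []) ∷ʳ a ⊑ T
      za with l , r , e ← ∷ʳ-⊑ (k ++ s) (Old⇒⊑ oldxa)
         with l′ , l≡ ← proj₁ (Closure.extend C (l ++ k) (a ∷ r)
                (trans (++-assoc l k _) (trans (cong (l ++_) (sym (++-assoc k s _))) e))) =
        ⊑-∷ʳ l′ (α ++ s ++ []) (begin
          l′ ++ (α ++ s ++ []) ++ a ∷ r ≡⟨ cong (λ t → l′ ++ (α ++ t) ++ a ∷ r) (++-identityʳ s) ⟩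
          l′ ++ (α ++ s) ++ a ∷ r       ≡⟨ cong (l′ ++_) (++-assoc α s _) ⟩
          l′ ++ α ++ s ++ a ∷ r         ≡⟨ sym (++-assoc l′ α _) ⟩
          (l′ ++ α) ++ s ++ a ∷ r       ≡⟨ cong (_++ s ++ a ∷ r) l≡ ⟩
          (l ++ k) ++ s ++ a ∷ r        ≡⟨ ++-assoc l k _ ⟩
          l ++ k ++ s ++ a ∷ r          ≡⟨ cong (l ++_) (sym (++-assoc k s _)) ⟩
          l ++ (k ++ s) ++ a ∷ r        ≡⟨ e ⟩
          T                             ∎)
        where open ≡-Reasoning

  size-bound : size T′ ≤ 8 * size T + 4
  size-bound = subst₂ _≤_ (length-edges T′) length-targets
    (pigeonhole (edges-unique T′)
      (λ e∈ → let lm , rm , xa = ∈-edges⁻ e∈ in charge lm rm xa) charge-injective)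

-- Reduction of the three edits to one form.

size-[] : ∀ σ → size {σ} [] ≡ 0
size-[] σ = trans (sym (length-edges {σ} [])) (cong length (¬∷⇒[] (edges {σ} []) λ e _ eq →
  no-edge e (subst (e ∈ˡ_) (sym eq) (here refl))))
  where
  no-edge : ∀ e → ¬ e ∈ˡ edges {σ} []
  no-edge (x , a) e∈ = contradiction (⊑-length (proj₂ (proj₂ (∈-edges⁻ {T = []} {x} {a} e∈))))
    (ℕ.<⇒≱ (subst (0 <_) (sym (length-∷ʳ x)) (s≤s z≤n)))

Bound : Str σ → Str σ → Set
Bound T T′ = size T′ ≤ 8 * size T + 4

-- The edit is moved to the left end of a run of equal letters to obtain change.
insertion-bound : ∀ {u} (a : Fin σ) v → Reverse u → Bound (u ++ v) (u ++ a ∷ v)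
insertion-bound a v [] = Edited.size-bound [] [] v a (contradiction refl)
insertion-bound a v (u ∶ ru ∶ʳ b) with b Fin.≟ a
... | yes refl = subst₂ Bound (sym (∷ʳ-++ u b v)) (sym (∷ʳ-++ u b (b ∷ v))) (insertion-bound b (b ∷ v) ru)
... | no b≢a = Edited.size-bound (u ∷ʳ b) [] v a λ _ av →
        b≢a (≽-∷-injective (u , sym (∷ʳ-++ u b v)) av)

-- To supply a letter `d`, the deletion of `a` is read as replacing `a` and a neighbour `b` by `b`;
-- the neighbour is taken on the left if there is one.
deletion-bound : ∀ {u} (a : Fin σ) v → Reverse u → Bound (u ++ a ∷ v) (u ++ v)
-- The result is empty and contains no letter to serve as `d`.
deletion-bound {σ} a [] [] = subst (_≤ 8 * size (a ∷ []) + 4) (sym (size-[] σ)) z≤n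
deletion-bound a (b ∷ v) [] = Edited.size-bound [] (a ∷ b ∷ []) v b (contradiction refl)
deletion-bound a v (u ∶ ru ∶ʳ b) with b Fin.≟ a
... | yes refl = subst₂ Bound (sym (∷ʳ-++ u b (b ∷ v))) (sym (∷ʳ-++ u b v)) (deletion-bound b (b ∷ v) ru)
... | no b≢a = subst₂ Bound (sym (∷ʳ-++ u b (a ∷ v))) (sym (∷ʳ-++ u b v))
        (Edited.size-bound u (b ∷ a ∷ []) v b λ _ bv →
          b≢a (≽-∷-injective bv (u ∷ʳ b , ∷ʳ-++ u b (a ∷ v))))

substitution-bound : ∀ u (a b : Fin σ) v → Bound (u ++ a ∷ v) (u ++ b ∷ v)
substitution-bound u a b v with a Fin.≟ b
-- `Edit` lets a letter be replaced by itself.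
... | yes refl = ≤-trans (ℕ.m≤n*m _ 8) (ℕ.m≤m+n _ 4)
... | no a≢b = Edited.size-bound u (a ∷ []) v b λ _ bv → a≢b (≽-∷-injective (u , refl) bv)

edit-bound : ∀ {T T′ : Str σ} → Edit T T′ → Bound T T′
edit-bound (insertion u a v)      = insertion-bound a v (reverseView u)
edit-bound (deletion u a v)       = deletion-bound a v (reverseView u)
edit-bound (substitution u a b v) = substitution-bound u a b v

-- A member `T′` of `𝒦 T 1` comes with an edit from `T′` to `T`, while the bound starts from `T`.
Edit-sym : ∀ {T T′ : Str σ} → Edit T T′ → Edit T′ T
Edit-sym (insertion u a v)      = deletion u a v
Edit-sym (deletion u a v)       = insertion u a v
Edit-sym (substitution u a b v) = substitution u b a v

ed≡1⇒Edit : ∀ {T T′ : Str σ} → ed[ T , T′ ]≡ 1 → Edit T T′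
ed≡1⇒Edit (step e done , _) = e

-- As unreduced fractions both sides keep the denominator `suc k`, which `mkℚᵘ` stores as `k`.
/-mono-≤ : ∀ {m n} k .{{_ : NonZero k}} → m ≤ n → (+ m /ℚ k) ≤ℚ (+ n /ℚ k)
/-mono-≤ {m} {n} (suc k) m≤n = ℚ.toℚᵘ-cancel-≤ (begin
  toℚᵘ (+ m /ℚ suc k) ≃⟨ ℚ.toℚᵘ-fromℚᵘ (mkℚᵘ (+ m) k) ⟩
  mkℚᵘ (+ m) k          ≤⟨ ℚᵘ.*≤* (ℤ.*-monoʳ-≤-nonNeg (+ suc k) (ℤ.+≤+ m≤n)) ⟩
  mkℚᵘ (+ n) k          ≃⟨ ℚᵘ.≃-sym (ℚ.toℚᵘ-fromℚᵘ (mkℚᵘ (+ n) k)) ⟩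
  toℚᵘ (+ n /ℚ suc k) ∎)
  where open ℚᵘ.≤-Reasoning

theorem1 : (σ : ℕ) →
    ((T T′ : Str σ) → ed[ T , T′ ]≡ 1 → size T′ ≤ 8 * size T + 4)
    × ((op : Op) (n : ℕ) .{{_ : NonZero n}} (p : Pair σ op n) →
    ratio p ≤ℚ (+ (8 * size (Pair.T p) + 4) /ℚ size (Pair.T p)) {{size-T-nonZero p}})
theorem1 σ =
    (λ T T′ ed → edit-bound (ed≡1⇒Edit ed))
  , (λ op n p → /-mono-≤ (size (Pair.T p)) {{size-T-nonZero p}}
       (edit-bound (Edit-sym (ed≡1⇒Edit (Pair.T′∈𝒦 p)))))
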